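{- Let $n\ge 1$. There is a natural bijection between the set $H^0(\widehat{X}_{W(\widetilde{A}_n)})$ of irreducible components of the Shi variety $\widehat{X}_{W(\widetilde{A}_n)}$ and the set of circular permutations of $W(A_n)=S_{n+1}$. Here "natural" means that the bijection $\Psi$ from circular permutations to components respects the actions of $W(A_n)$, i.e. $\Psi(\sigma c\sigma^{ -1})=\sigma\diamond\Psi(c)$ for all $\sigma\in W(A_n)$ and all circular permutations $c$. In particular $|H^0(\widehat{X}_{W(\widetilde{A}_n)})|=n!$.
   Context: Let $W(A_n)=S_{n+1}$; a circular permutation is an $(n+1)$-cycle in $S_{n+1}$, and $W(A_n)$ acts on circular permutations by conjugation. Let $m=n(n+1)/2$ and index the coordinates of $\mathbb{R}^m$ by pairs $(i,j)$ with $1\le i<j\le n+1$ (the pair $(i,j)$ corresponds to the positive root $e_i-e_j$ of type $A_n$). An admitted vector is a vector of integers $\lambda=(\lambda_{i,j})_{1\le i<j\le n+1}$ such that $\lambda_{i,i+1}=0$ for all $1\le i\le n$ and $\lambda_{i,j}+\lambda_{j,k}\le\lambda_{i,k}\le\lambda_{i,j}+\lambda_{j,k}+1$ for all $1\le i<j<k\le n+1$. For an admitted vector $\lambda$, let $X_{W(\widetilde{A}_n)}[\lambda]=\{x\in\mathbb{R}^m : x_{i,j}=\sum_{r=i}^{j-1}x_{r,r+1}+\lambda_{i,j}\text{ for all }1\le i<j\le n+1\}$. The Shi variety is $\widehat{X}_{W(\widetilde{A}_n)}=\bigsqcup_{\lambda\text{ admitted}}X_{W(\widetilde{A}_n)}[\lambda]\subset\mathbb{R}^m$,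 and its set of irreducible components is $H^0(\widehat{X}_{W(\widetilde{A}_n)})=\{X_{W(\widetilde{A}_n)}[\lambda] : \lambda\text{ admitted}\}$. The $\Phi^+$-representation (restricted to $W(A_n)$) is the homomorphism $F:W(A_n)\to\mathrm{Isom}(\mathbb{R}^m)$ given by: for $w\in S_{n+1}$, $x\in\mathbb{R}^m$ and $i<j$, $F(w)(x)_{i,j}=x_{w^{ -1}(i),w^{ -1}(j)}$ if $w^{ -1}(i)<w^{ -1}(j)$, and $F(w)(x)_{i,j}=-x_{w^{ -1}(j),w^{ -1}(i)}-1$ if $w^{ -1}(i)>w^{ -1}(j)$. It is known that each $F(w)$ permutes the sets $X_{W(\widetilde{A}_n)}[\lambda]$, $\lambda$ admitted; this gives the action $w\diamond X_{W(\widetilde{A}_n)}[\lambda]:=F(w)(X_{W(\widetilde{A}_n)}[\lambda])$ of $W(A_n)$ on $H^0(\widehat{X}_{W(\widetilde{A}_n)})$. -}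

module Defs where

open import Algebra.Bundles using (module CommutativeMonoid)
open import Algebra.Bundles.Raw using (RawMonoid)
import Algebra.Definitions.RawMonoid as RawMonoidDefs
open import Data.Bool.Base using (if_then_else_; _∧_)
open import Data.Empty using (⊥-elim-irr)
open import Data.Fin.Base using (Fin; zero; suc; inject₁; fromℕ; _<_)
open import Data.Fin.Permutation
  using (Permutation′; _⟨$⟩ʳ_; _⟨$⟩ˡ_; _∘ₚ_; flip; inverseˡ; inverseʳ)
open import Data.Fin.Properties using (_≤?_; _<?_; <-cmp; <-irrefl; ≤̄⇒inject₁<)
open import Data.Integer.Base as ℤ using (ℤ; 0ℤ; 1ℤ)
open import Data.Nat.Base as ℕ using (ℕ; suc)
import Data.Nat.Properties as ℕₚ
open import Data.Product.Base using (Σ; Σ-syntax; ∃-syntax; _×_; _,_; proj₁; proj₂)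
open import Data.Rational.Base as ℚ using (ℚ; 0ℚ; ½)
import Data.Rational.Properties as ℚₚ
open import Algebra.Properties.AbelianGroup ℚₚ.+-0-abelianGroup using (⁻¹-∙-comm)
open import Algebra.Properties.CommutativeSemigroup
  (CommutativeMonoid.commutativeSemigroup ℚₚ.+-0-commutativeMonoid)
  using (interchange)
open import Level using (0ℓ) renaming (suc to lsuc)
open import Relation.Binary.Bundles using (Setoid)
import Relation.Binary.Construct.On as On
open import Relation.Binary.Definitions using (tri<; tri≈; tri>)
open import Relation.Binary.PropositionalEquality
  using (_≡_; refl; sym; trans; cong; subst; _→-setoid_)
open import Relation.Nullary.Decidable using (does)
open import Relation.Unary using (Pred; _≐_)
open import Relation.Unary.Relation.Binary.Equality using (≐-setoid)

------------------------------------------------------------------------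
-- Real numbers: Cauchy sequences of rationals, compared by `_≃_`
-- (the difference tends to 0).

IsCauchy : (ℕ → ℚ) → Set
IsCauchy x = ∀ ε → 0ℚ ℚ.< ε → ∃[ N ] ∀ k l → N ℕ.≤ k → N ℕ.≤ l →
  ℚ.∣ x k ℚ.- x l ∣ ℚ.< ε

record ℝ : Set where
  constructor mkℝ
  field
    seq    : ℕ → ℚ
    cauchy : IsCauchy seq

open ℝ public

infix 4 _≃_

_≃_ : ℝ → ℝ → Set
x ≃ y = ∀ ε → 0ℚ ℚ.< ε → ∃[ N ] ∀ k → N ℕ.≤ k → ℚ.∣ seq x k ℚ.- seq y k ∣ ℚ.< ε

private
  halve-pos : ∀ {ε} → 0ℚ ℚ.< ε → 0ℚ ℚ.< ½ ℚ.* ε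
  halve-pos {ε} 0<ε = subst (ℚ._< ½ ℚ.* ε) (ℚₚ.*-zeroʳ ½) (ℚₚ.*-monoʳ-<-pos ½ 0<ε)

  halves : ∀ ε → ½ ℚ.* ε ℚ.+ ½ ℚ.* ε ≡ ε
  halves ε = trans (sym (ℚₚ.*-distribʳ-+ ε ½ ½)) (ℚₚ.*-identityˡ ε)

  +-minus : ∀ a b c d → (a ℚ.+ b) ℚ.- (c ℚ.+ d) ≡ (a ℚ.- c) ℚ.+ (b ℚ.- d)
  +-minus a b c d = trans (cong ((a ℚ.+ b) ℚ.+_) (sym (⁻¹-∙-comm c d)))
                          (interchange a b (ℚ.- c) (ℚ.- d))

  cauchy-+ : ∀ {x y} → IsCauchy x → IsCauchy y → IsCauchy (λ k → x k ℚ.+ y k)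
  cauchy-+ {x} {y} cx cy ε 0<ε
    with cx (½ ℚ.* ε) (halve-pos 0<ε) | cy (½ ℚ.* ε) (halve-pos 0<ε)
  ... | M , hx | N , hy = M ℕ.⊔ N , λ k l p q →
    subst (ℚ.∣ (x k ℚ.+ y k) ℚ.- (x l ℚ.+ y l) ∣ ℚ.<_) (halves ε)
      (subst (λ z → ℚ.∣ z ∣ ℚ.< ½ ℚ.* ε ℚ.+ ½ ℚ.* ε) (sym (+-minus (x k) (y k) (x l) (y l)))
        (ℚₚ.≤-<-trans (ℚₚ.∣p+q∣≤∣p∣+∣q∣ (x k ℚ.- x l) (y k ℚ.- y l))
          (ℚₚ.+-mono-<
            (hx k l (ℕₚ.≤-trans (ℕₚ.m≤m⊔n M N) p) (ℕₚ.≤-trans (ℕₚ.m≤m⊔n M N) q))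
            (hy k l (ℕₚ.≤-trans (ℕₚ.m≤n⊔m M N) p) (ℕₚ.≤-trans (ℕₚ.m≤n⊔m M N) q)))))

  cauchy-neg : ∀ {x} → IsCauchy x → IsCauchy (λ k → ℚ.- x k)
  cauchy-neg {x} cx ε 0<ε with cx ε 0<ε
  ... | N , h = N , λ k l p q →
    subst (ℚ._< ε)
      (trans (sym (ℚₚ.∣-p∣≡∣p∣ (x k ℚ.- x l)))
             (cong ℚ.∣_∣ (sym (⁻¹-∙-comm (x k) (ℚ.- x l)))))
      (h k l p q)

  cauchy-const : ∀ q → IsCauchy (λ _ → q)
  cauchy-const q ε 0<ε = 0 , λ _ _ _ _ →
    subst (λ z → ℚ.∣ z ∣ ℚ.< ε) (sym (ℚₚ.+-inverseʳ q)) 0<ε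

infixl 6 _+ᵣ_
infix  8 -ᵣ_

_+ᵣ_ : ℝ → ℝ → ℝ
x +ᵣ y = mkℝ (λ k → seq x k ℚ.+ seq y k) (cauchy-+ {seq x} {seq y} (cauchy x) (cauchy y))

-ᵣ_ : ℝ → ℝ
-ᵣ x = mkℝ (λ k → ℚ.- seq x k) (cauchy-neg {seq x} (cauchy x))

fromℤ : ℤ → ℝ
fromℤ z = mkℝ (λ _ → z ℚ./ 1) (cauchy-const (z ℚ./ 1))

+ᵣ-rawMonoid : RawMonoid 0ℓ 0ℓ
+ᵣ-rawMonoid = record { Carrier = ℝ ; _≈_ = _≃_ ; _∙_ = _+ᵣ_ ; ε = fromℤ 0ℤ }

open RawMonoidDefs +ᵣ-rawMonoid using (sum) public

------------------------------------------------------------------------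
-- Vectors indexed by the positive roots of type Aₙ, i.e. by the pairs
-- i < j in Fin (suc n); indices run over 0,…,n instead of 1,…,n+1.

Coords : ℕ → Set → Set
Coords n A = (i j : Fin (suc n)) → .(i < j) → A

-- The coordinate (r , r+1).
simple : ∀ {n} {A : Set} → Coords n A → Fin n → A
simple x r = x (inject₁ r) (suc r) (≤̄⇒inject₁< ℕₚ.≤-refl)

ℝ^Φ⁺ : ℕ → Set
ℝ^Φ⁺ n = Coords n ℝ

infix 4 _≋_

_≋_ : ∀ {n} → ℝ^Φ⁺ n → ℝ^Φ⁺ n → Set
x ≋ y = ∀ i j .(i<j : i < j) → x i j i<j ≃ y i j i<j

-- x_{i,i+1} + … + x_{j-1,j}
simpleSum : ∀ {n} → ℝ^Φ⁺ n → (i j : Fin (suc n)) → ℝ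
simpleSum x i j = sum λ r →
  if does (i ≤? inject₁ r) ∧ does (inject₁ r <? j) then simple x r else fromℤ 0ℤ

------------------------------------------------------------------------
-- Shi variety

record Admitted {n} (v : Coords n ℤ) : Set where
  field
    simple≡0 : ∀ r → simple v r ≡ 0ℤ
    lower    : ∀ i j k .(i<j : i < j) .(j<k : j < k) .(i<k : i < k) →
               v i j i<j ℤ.+ v j k j<k ℤ.≤ v i k i<k
    upper    : ∀ i j k .(i<j : i < j) .(j<k : j < k) .(i<k : i < k) →
               v i k i<k ℤ.≤ v i j i<j ℤ.+ v j k j<k ℤ.+ 1ℤ

X[_] : ∀ {n} → Coords n ℤ → Pred (ℝ^Φ⁺ n) 0ℓ
X[ v ] x = ∀ i j .(i<j : i < j) → x i j i<j ≃ simpleSum x i j +ᵣ fromℤ (v i j i<j)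

-- The irreducible components are the subsets of ℝ^Φ⁺ n of the form
-- X[ v ] with v admitted. They are compared as subsets: v is not part of
-- the equality.
H⁰ : ℕ → Setoid (lsuc 0ℓ) 0ℓ
H⁰ n = On.setoid {B = Σ[ P ∈ Pred (ℝ^Φ⁺ n) 0ℓ ] ∃[ v ] Admitted v × P ≐ X[ v ]}
                 (≐-setoid (ℝ^Φ⁺ n) 0ℓ) proj₁

------------------------------------------------------------------------
-- Φ⁺-representation of W(Aₙ) = S_{n+1}

W : ℕ → Set
W n = Permutation′ (suc n)

F : ∀ {n} → W n → ℝ^Φ⁺ n → ℝ^Φ⁺ n
F w x i j i<j with <-cmp (w ⟨$⟩ˡ i) (w ⟨$⟩ˡ j)
... | tri< lt _ _ = x (w ⟨$⟩ˡ i) (w ⟨$⟩ˡ j) lt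
... | tri≈ _ eq _ = ⊥-elim-irr (<-irrefl i≡j i<j)
  where
  i≡j : i ≡ j
  i≡j = trans (sym (inverseʳ w)) (trans (cong (w ⟨$⟩ʳ_) eq) (inverseʳ w))
... | tri> _ _ gt = -ᵣ x (w ⟨$⟩ˡ j) (w ⟨$⟩ˡ i) gt +ᵣ -ᵣ fromℤ 1ℤ

infixr 7 _◇_

-- The image of a subset under F w.
_◇_ : ∀ {n} → W n → Pred (ℝ^Φ⁺ n) 0ℓ → Pred (ℝ^Φ⁺ n) 0ℓ
(w ◇ P) y = ∃[ x ] P x × y ≋ F w x

------------------------------------------------------------------------
-- Circular permutations

-- c is the (n+1)-cycle (a₀ a₁ … aₙ) for some enumeration a of the points.
IsCircular : ∀ {n} → W n → Set
IsCircular {n} c = Σ[ a ∈ Permutation′ (suc n) ]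
  (∀ r → c ⟨$⟩ʳ (a ⟨$⟩ʳ inject₁ r) ≡ a ⟨$⟩ʳ suc r) ×
  c ⟨$⟩ʳ (a ⟨$⟩ʳ fromℕ n) ≡ a ⟨$⟩ʳ zero

CircularPermutation : ℕ → Set
CircularPermutation n = Σ (W n) IsCircular

-- Equality is pointwise equality of the underlying permutations.
Circular : ℕ → Setoid 0ℓ 0ℓ
Circular n = On.setoid {B = CircularPermutation n}
                       (Fin (suc n) →-setoid Fin (suc n)) (λ c → proj₁ c ⟨$⟩ʳ_)

-- σ c σ⁻¹; note that `_∘ₚ_` composes from left to right.
conj : ∀ {n} → W n → CircularPermutation n → CircularPermutation n
conj σ (c , a , step , close) =
  flip σ ∘ₚ c ∘ₚ σ , a ∘ₚ σ ,
  (λ r → cong (σ ⟨$⟩ʳ_) (trans (cong (c ⟨$⟩ʳ_) (inverseˡ σ)) (step r))) ,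
  cong (σ ⟨$⟩ʳ_) (trans (cong (c ⟨$⟩ʳ_) (inverseˡ σ)) close)

{-# OPTIONS --safe #-}

-- Enumerate a circular permutation c as a₀, …, aₙ and let e(i,j) = 1 if j precedes i in this
-- enumeration and e(i,j) = 0 otherwise. The component attached to c is
--   Y[e] = { x : x_{i,j} = t_j − t_i − e(i,j) for some real potential t }.
-- It is X[λ] for λ_{i,j} = h_j − h_i − e(i,j), where h_j is the number of descents e(r,r+1) = 1
-- with r < j. In this form F(w) only permutes the indices, so that equivariance is immediate.
-- Y[e] depends on e up to a coboundary, hence only on the alternating 3-cochain
-- e(i,j) + e(j,k) − e(i,k) ∈ {0,1}, which is the cyclic order of i, j, k along c: changing the
-- starting point a₀ rotates the positions and alters e by a coboundary, and c(i) is recovered from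
-- the cyclic order as the point with nothing between i and it. Conversely the admissibility
-- inequalities say that λ_{i,k} − λ_{i,j} − λ_{j,k} is a cyclic order; reading it from the base
-- point 0 gives a strict total order on the other points, and sorting them gives c. So the
-- components correspond to the orderings of n points.
module Submission where

open import Defs
open import Algebra.Bundles using (Monoid; AbelianGroup)
open import Data.Bool.Base using (Bool; if_then_else_; _∧_)
open import Data.Empty using (⊥-elim-irr)
import Data.Fin.Base as Fin
open import Data.Fin.Base
  using (Fin; zero; suc; inject₁; fromℕ; fromℕ<; toℕ; punchIn; punchOut; combine; remQuot; _<_)
open import Data.Fin.Induction using (<-weakInduction)
open import Data.Fin.Permutation
  using (Permutation′; permutation; lift₀; lift₀-cong; insert; insert-punchIn; insert-remove; remove;
         flip; _∘ₚ_; _⟨$⟩ʳ_; _⟨$⟩ˡ_; inverseˡ; inverseʳ)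
  renaming (id to idₚ; _≈_ to _≈ₚ_)
open import Data.Fin.Properties
  using (_≟_; _≤?_; _<?_; any?; <-cmp; <-irrefl; ≤̄⇒inject₁<; toℕ<n; toℕ≤pred[n]; toℕ-injective;
         toℕ-inject₁; toℕ-fromℕ; toℕ-fromℕ<; punchIn-injective; punchOut-injective; injective⇒≤;
         suc-injective; combine-remQuot; remQuot-combine)
open import Data.Fin.Relation.Unary.Top using (View; view; ‵fromℕ; ‵inject₁)
open import Data.Fin.Subset using (Subset; ∣_∣; _∈_; ⊤)
open import Data.Fin.Subset.Properties using (p⊂q⇒∣p∣<∣q∣; ∣⊤∣≡n; ∈⊤)
open import Data.Integer.Base as ℤ using (ℤ; 0ℤ; 1ℤ; -1ℤ; +_)
import Data.Integer.Properties as ℤₚ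
open import Data.Integer.Tactic.RingSolver using (solve-∀)
open import Data.Nat.Base as ℕ using (ℕ; zero; suc; _≤_; _!; _≤ᵇ_)
import Data.Nat.Properties as ℕₚ
open import Data.Product.Base using (Σ-syntax; ∃-syntax; _×_; _,_; proj₁; proj₂)
open import Data.Rational.Base as ℚ using (ℚ; 0ℚ; 1ℚ; ½)
import Data.Rational.Properties as ℚₚ
import Data.Rational.Unnormalised.Base as ℚᵘ
import Data.Rational.Unnormalised.Properties as ℚᵘₚ
open import Data.Sum.Base using (_⊎_; inj₁; inj₂)
open import Data.Vec.Base using (tabulate)
open import Data.Vec.Properties using (lookup∘tabulate; []=⇒lookup; lookup⇒[]=)
open import Function.Base using (_∘_)
open import Function.Bundles using (Bijection)
open import Function.Definitions using (Injective)
open import Level using (0ℓ)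
open import Relation.Binary.Bundles using (Setoid)
open import Relation.Binary.Core using (Rel)
open import Relation.Binary.Definitions using (Tri; tri<; tri≈; tri>; Trichotomous)
open import Relation.Binary.PropositionalEquality
  using (_≡_; _≢_; refl; sym; trans; cong; cong₂; subst; subst₂; setoid; isEquivalence;
         module ≡-Reasoning)
import Relation.Binary.Reasoning.Setoid as SetoidReasoning
open import Relation.Binary.Structures using (IsStrictTotalOrder)
open import Relation.Binary.Structures.Biased using (isStrictTotalOrderᶜ)
open import Relation.Nullary.Decidable using (Dec; yes; no; does; recompute; dec-true; dec⇒maybe)
open import Relation.Nullary.Negation using (¬_; contradiction)
open import Relation.Unary using (Pred; _≐_; _⊆_)
open import Relation.Unary.Properties using (≐-sym; ≐-trans)
import Tactic.RingSolver as RingSolver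
open import Tactic.RingSolver.Core.AlmostCommutativeRing
  using (AlmostCommutativeRing; fromCommutativeRing)

-- The additive group of real numbers

ℚ-ring : AlmostCommutativeRing 0ℓ 0ℓ
ℚ-ring = fromCommutativeRing ℚₚ.+-*-commutativeRing (λ q → dec⇒maybe (0ℚ ℚₚ.≟ q))

≃-reflexive : ∀ {x y} → (∀ k → seq x k ≡ seq y k) → x ≃ y
≃-reflexive {x} {y} x≡y ε 0<ε = 0 , λ k _ →
  subst (λ z → ℚ.∣ z ∣ ℚ.< ε)
    (trans (sym (ℚₚ.+-inverseʳ (seq y k))) (cong (ℚ._- seq y k) (sym (x≡y k)))) 0<ε

≃-refl : ∀ {x} → x ≃ x
≃-refl {x} = ≃-reflexive {x} {x} (λ _ → refl)

-- The absolute value ignores the sign, so the same `N` serves. Symmetry and negation thereby reduce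
-- to identities in ℚ.
≃-from-negation : ∀ {x y a b} → a ≃ b →
  (∀ k → seq x k ℚ.- seq y k ≡ ℚ.- (seq a k ℚ.- seq b k)) → x ≃ y
≃-from-negation {a = a} {b} a≃b eq ε 0<ε with a≃b ε 0<ε
... | N , h = N , λ k N≤k →
  subst (ℚ._< ε)
    (trans (sym (ℚₚ.∣-p∣≡∣p∣ (seq a k ℚ.- seq b k))) (cong ℚ.∣_∣ (sym (eq k)))) (h k N≤k)

-- Half of `ε` goes to each hypothesis. Transitivity and compatibility with addition thereby reduce
-- to identities in ℚ.
≃-from-sum : ∀ {x y a b c d} → a ≃ b → c ≃ d →
  (∀ k → seq x k ℚ.- seq y k ≡ (seq a k ℚ.- seq b k) ℚ.+ (seq c k ℚ.- seq d k)) → x ≃ y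
≃-from-sum {x} {y} {a} {b} {c} {d} a≃b c≃d eq ε 0<ε
  with a≃b (½ ℚ.* ε) 0<½ε | c≃d (½ ℚ.* ε) 0<½ε
  where
  0<½ε : 0ℚ ℚ.< ½ ℚ.* ε
  0<½ε = subst (ℚ._< ½ ℚ.* ε) (ℚₚ.*-zeroʳ ½) (ℚₚ.*-monoʳ-<-pos ½ 0<ε)
... | M , h₁ | N , h₂ = M ℕ.⊔ N , λ k p → begin-strict
    ℚ.∣ seq x k ℚ.- seq y k ∣
      ≡⟨ cong ℚ.∣_∣ (eq k) ⟩
    ℚ.∣ (seq a k ℚ.- seq b k) ℚ.+ (seq c k ℚ.- seq d k) ∣
      ≤⟨ ℚₚ.∣p+q∣≤∣p∣+∣q∣ (seq a k ℚ.- seq b k) (seq c k ℚ.- seq d k) ⟩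
    ℚ.∣ seq a k ℚ.- seq b k ∣ ℚ.+ ℚ.∣ seq c k ℚ.- seq d k ∣
      <⟨ ℚₚ.+-mono-< (h₁ k (ℕₚ.≤-trans (ℕₚ.m≤m⊔n M N) p))
                     (h₂ k (ℕₚ.≤-trans (ℕₚ.m≤n⊔m M N) p)) ⟩
    ½ ℚ.* ε ℚ.+ ½ ℚ.* ε
      ≡⟨ ℚₚ.*-distribʳ-+ ε ½ ½ ⟨
    1ℚ ℚ.* ε
      ≡⟨ ℚₚ.*-identityˡ ε ⟩
    ε ∎
  where open ℚₚ.≤-Reasoning

≃-sym : ∀ {x y} → x ≃ y → y ≃ x
≃-sym {x} {y} x≃y = ≃-from-negation {y} {x} {x} {y} x≃y (λ k → lemma (seq x k) (seq y k))
  where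
  lemma : ∀ p q → q ℚ.- p ≡ ℚ.- (p ℚ.- q)
  lemma = RingSolver.solve-∀ ℚ-ring

≃-trans : ∀ {x y z} → x ≃ y → y ≃ z → x ≃ z
≃-trans {x} {y} {z} x≃y y≃z =
  ≃-from-sum {x} {z} {x} {y} {y} {z} x≃y y≃z (λ k → lemma (seq x k) (seq y k) (seq z k))
  where
  lemma : ∀ p q r → p ℚ.- r ≡ (p ℚ.- q) ℚ.+ (q ℚ.- r)
  lemma = RingSolver.solve-∀ ℚ-ring

+ᵣ-cong : ∀ {x y u v} → x ≃ y → u ≃ v → x +ᵣ u ≃ y +ᵣ v
+ᵣ-cong {x} {y} {u} {v} x≃y u≃v =
  ≃-from-sum {x +ᵣ u} {y +ᵣ v} {x} {y} {u} {v} x≃y u≃v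
    (λ k → lemma (seq x k) (seq y k) (seq u k) (seq v k))
  where
  lemma : ∀ p q r s → (p ℚ.+ r) ℚ.- (q ℚ.+ s) ≡ (p ℚ.- q) ℚ.+ (r ℚ.- s)
  lemma = RingSolver.solve-∀ ℚ-ring

-ᵣ-cong : ∀ {x y} → x ≃ y → -ᵣ x ≃ -ᵣ y
-ᵣ-cong {x} {y} x≃y =
  ≃-from-negation { -ᵣ x} { -ᵣ y} {x} {y} x≃y (λ k → lemma (seq x k) (seq y k))
  where
  lemma : ∀ p q → (ℚ.- p) ℚ.- (ℚ.- q) ≡ ℚ.- (p ℚ.- q)
  lemma = RingSolver.solve-∀ ℚ-ring

+ᵣ-abelianGroup : AbelianGroup 0ℓ 0ℓ
+ᵣ-abelianGroup = record
  { Carrier = ℝ ; _≈_ = _≃_ ; _∙_ = _+ᵣ_ ; ε = fromℤ 0ℤ ; _⁻¹ = -ᵣ_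
  ; isAbelianGroup = record
    { isGroup = record
      { isMonoid = record
        { isSemigroup = record
          { isMagma = record
            { isEquivalence = record
              { refl  = λ {x} → ≃-refl {x}
              ; sym   = λ {x} {y} → ≃-sym {x} {y}
              ; trans = λ {x} {y} {z} → ≃-trans {x} {y} {z} }
            ; ∙-cong = λ {x} {y} {u} {v} → +ᵣ-cong {x} {y} {u} {v} }
          ; assoc = λ x y z → ≃-reflexive {(x +ᵣ y) +ᵣ z} {x +ᵣ (y +ᵣ z)}
                      (λ k → ℚₚ.+-assoc (seq x k) (seq y k) (seq z k)) }
        ; identity = (λ x → ≃-reflexive {fromℤ 0ℤ +ᵣ x} {x} (λ k → ℚₚ.+-identityˡ (seq x k)))
                   , (λ x → ≃-reflexive {x +ᵣ fromℤ 0ℤ} {x} (λ k → ℚₚ.+-identityʳ (seq x k))) }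
      ; inverse = (λ x → ≃-reflexive { -ᵣ x +ᵣ x} {fromℤ 0ℤ} (λ k → ℚₚ.+-inverseˡ (seq x k)))
                , (λ x → ≃-reflexive {x +ᵣ -ᵣ x} {fromℤ 0ℤ} (λ k → ℚₚ.+-inverseʳ (seq x k)))
      ; ⁻¹-cong = λ {x} {y} → -ᵣ-cong {x} {y} }
    ; comm = λ x y → ≃-reflexive {x +ᵣ y} {y +ᵣ x} (λ k → ℚₚ.+-comm (seq x k) (seq y k)) } }

-- The integers in ℚ and ℝ

ι : ℤ → ℚ
ι i = i ℚ./ 1

toℚᵘ-ι : ∀ i → ℚ.toℚᵘ (ι i) ℚᵘ.≃ ℚᵘ.mkℚᵘ i 0
toℚᵘ-ι i = ℚₚ.toℚᵘ-fromℚᵘ (ℚᵘ.mkℚᵘ i 0)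

ι-+ : ∀ i j → ι (i ℤ.+ j) ≡ ι i ℚ.+ ι j
ι-+ i j = ℚₚ.toℚᵘ-injective (begin
  ℚ.toℚᵘ (ι (i ℤ.+ j))               ≈⟨ toℚᵘ-ι (i ℤ.+ j) ⟩
  ℚᵘ.mkℚᵘ (i ℤ.+ j) 0                ≈⟨ ℚᵘ.*≡* (cong (ℤ._* 1ℤ) (sym (cong₂ ℤ._+_ (ℤₚ.*-identityʳ i) (ℤₚ.*-identityʳ j)))) ⟩
  ℚᵘ.mkℚᵘ i 0 ℚᵘ.+ ℚᵘ.mkℚᵘ j 0       ≈⟨ ℚᵘₚ.+-cong (toℚᵘ-ι i) (toℚᵘ-ι j) ⟨
  ℚ.toℚᵘ (ι i) ℚᵘ.+ ℚ.toℚᵘ (ι j)     ≈⟨ ℚₚ.toℚᵘ-homo-+ (ι i) (ι j) ⟨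
  ℚ.toℚᵘ (ι i ℚ.+ ι j)               ∎)
  where open ℚᵘₚ.≃-Reasoning

ι-neg : ∀ i → ι (ℤ.- i) ≡ ℚ.- ι i
ι-neg i = ℚₚ.toℚᵘ-injective (begin
  ℚ.toℚᵘ (ι (ℤ.- i))       ≈⟨ toℚᵘ-ι (ℤ.- i) ⟩
  ℚᵘ.- ℚᵘ.mkℚᵘ i 0         ≈⟨ ℚᵘₚ.-‿cong (toℚᵘ-ι i) ⟨
  ℚᵘ.- ℚ.toℚᵘ (ι i)        ≈⟨ ℚₚ.toℚᵘ-homo‿- (ι i) ⟨
  ℚ.toℚᵘ (ℚ.- ι i)         ∎)
  where open ℚᵘₚ.≃-Reasoning

ι-sub : ∀ i j → ι (i ℤ.- j) ≡ ι i ℚ.- ι j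
ι-sub i j = trans (ι-+ i (ℤ.- j)) (cong (ι i ℚ.+_) (ι-neg j))

ι-cancel-< : ∀ i j → ι i ℚ.< ι j → i ℤ.< j
ι-cancel-< i j ιi<ιj with ℚᵘₚ.<-respˡ-≃ (toℚᵘ-ι i) (ℚᵘₚ.<-respʳ-≃ (toℚᵘ-ι j) (ℚₚ.toℚᵘ-mono-< ιi<ιj))
... | ℚᵘ.*<* p = subst₂ ℤ._<_ (ℤₚ.*-identityʳ i) (ℤₚ.*-identityʳ j) p

ι-∣∣ : ∀ i → ℚ.∣ ι i ∣ ≡ ι (ℤ.+ ℤ.∣ i ∣)
ι-∣∣ i = ℚₚ.toℚᵘ-injective (begin
  ℚ.toℚᵘ ℚ.∣ ι i ∣         ≈⟨ ℚₚ.toℚᵘ-homo-∣-∣ (ι i) ⟩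
  ℚᵘ.∣ ℚ.toℚᵘ (ι i) ∣      ≈⟨ ℚᵘₚ.∣-∣-cong (toℚᵘ-ι i) ⟩
  ℚᵘ.mkℚᵘ (ℤ.+ ℤ.∣ i ∣) 0  ≈⟨ toℚᵘ-ι (ℤ.+ ℤ.∣ i ∣) ⟨
  ℚ.toℚᵘ (ι (ℤ.+ ℤ.∣ i ∣)) ∎)
  where open ℚᵘₚ.≃-Reasoning

-- At ε = 1 the distance of the two integers is a natural number below 1.
fromℤ-injective : ∀ {i j} → fromℤ i ≃ fromℤ j → i ≡ j
fromℤ-injective {i} {j} i≃j with i≃j 1ℚ (ℚ.*<* (ℤ.+<+ (ℕ.s≤s ℕ.z≤n)))
... | N , h = ℤₚ.i-j≡0⇒i≡j i j (ℤₚ.∣i∣≡0⇒i≡0 (ℕₚ.n<1⇒n≡0 (ℤₚ.drop‿+<+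
  (ι-cancel-< (ℤ.+ ℤ.∣ i ℤ.- j ∣) 1ℤ
    (subst (ℚ._< 1ℚ) (trans (cong ℚ.∣_∣ (sym (ι-sub i j))) (ι-∣∣ (i ℤ.- j))) (h N ℕₚ.≤-refl))))))

module ℝ+ = AbelianGroup +ᵣ-abelianGroup
module ≃-Reasoning = SetoidReasoning ℝ+.setoid

-- Partial sums and telescoping

module PartialSums {c ℓ} (M : Monoid c ℓ) where
  open Monoid M renaming (refl to ≈-refl; sym to ≈-sym; trans to ≈-trans)

  partialSum : ∀ {n} → (Fin n → Carrier) → Fin (suc n) → Carrier
  partialSum         f zero    = ε
  partialSum {suc n} f (suc r) = f zero ∙ partialSum (f ∘ suc) r

  partialSum-suc : ∀ {n} (f : Fin n → Carrier) r →
    partialSum f (suc r) ≈ partialSum f (inject₁ r) ∙ f r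
  partialSum-suc f zero    = ≈-trans (identityʳ (f zero)) (≈-sym (identityˡ (f zero)))
  partialSum-suc f (suc r) =
    ≈-trans (∙-congˡ (partialSum-suc (f ∘ suc) r))
            (≈-sym (assoc (f zero) (partialSum (f ∘ suc) (inject₁ r)) (f (suc r))))

between : ∀ {n} (i j : Fin (suc n)) → Fin n → Bool
between i j r = does (i ≤? inject₁ r) ∧ does (inject₁ r <? j)

between-suc : ∀ {n} (i j : Fin (suc n)) r →
  between (suc i) (suc j) (suc r) ≡ between i j r
-- The upper test reduces by computation; `≤ᵇ` between successors does so only after a case split on
-- its left argument.
between-suc i j r = cong (_∧ does (inject₁ r <? j)) (lemma (toℕ i) (toℕ (inject₁ r)))
  where
  lemma : ∀ m k → (suc m ≤ᵇ suc k) ≡ (m ≤ᵇ k)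
  lemma zero    k = refl
  lemma (suc m) k = refl

sum-cong : ∀ {n} {f g : Fin n → ℝ} → (∀ r → f r ≃ g r) → sum f ≃ sum g
sum-cong {zero}          f≃g = ℝ+.refl {fromℤ 0ℤ}
sum-cong {suc n} {f} {g} f≃g =
  +ᵣ-cong {f zero} {g zero} {sum (f ∘ suc)} {sum (g ∘ suc)} (f≃g zero) (sum-cong (f≃g ∘ suc))

-- Induction on `n` splits off the first summand: it contributes the first increment of `g` when `i`
-- is zero and `j` is not, and vanishes otherwise. The tail is a shorter instance.
sum-telescope : ∀ {n} (f : Fin n → ℝ) (g : Fin (suc n) → ℝ) →
  (∀ r → f r ≃ g (suc r) +ᵣ -ᵣ g (inject₁ r)) → ∀ i j → i Fin.≤ j →
  sum (λ r → if between i j r then f r else fromℤ 0ℤ) ≃ g j +ᵣ -ᵣ g i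
sum-telescope {zero}  f g f≃Δg zero zero i≤j =
  ℝ+.sym {g zero +ᵣ -ᵣ g zero} {fromℤ 0ℤ} (ℝ+.inverseʳ (g zero))
sum-telescope {suc n} f g f≃Δg zero zero i≤j = begin
  fromℤ 0ℤ +ᵣ sum {n} (λ r → fromℤ 0ℤ)
    ≈⟨ ℝ+.identityˡ (sum {n} (λ r → fromℤ 0ℤ)) ⟩
  sum {n} (λ r → fromℤ 0ℤ)
    -- A sum of zeros only: the induction hypothesis over the empty interval evaluates it.
    ≈⟨ sum-telescope (f ∘ suc) (g ∘ suc) (f≃Δg ∘ suc) zero zero ℕ.z≤n ⟩
  g (suc zero) +ᵣ -ᵣ g (suc zero)
    ≈⟨ ℝ+.inverseʳ (g (suc zero)) ⟩
  fromℤ 0ℤ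
    ≈⟨ ℝ+.inverseʳ (g zero) ⟨
  g zero +ᵣ -ᵣ g zero ∎
  where open ≃-Reasoning
sum-telescope {suc n} f g f≃Δg zero (suc j) i≤j = begin
  f zero +ᵣ tailSum
    ≈⟨ +ᵣ-cong {f zero} {g (suc zero) +ᵣ -ᵣ g zero} {tailSum} {g (suc j) +ᵣ -ᵣ g (suc zero)}
         (f≃Δg zero) (sum-telescope (f ∘ suc) (g ∘ suc) (f≃Δg ∘ suc) zero j ℕ.z≤n) ⟩
  (g (suc zero) +ᵣ -ᵣ g zero) +ᵣ (g (suc j) +ᵣ -ᵣ g (suc zero))
    ≈⟨ ≃-reflexive {(g (suc zero) +ᵣ -ᵣ g zero) +ᵣ (g (suc j) +ᵣ -ᵣ g (suc zero))} {g (suc j) +ᵣ -ᵣ g zero}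
         (λ k → lemma (seq (g zero) k) (seq (g (suc zero)) k) (seq (g (suc j)) k)) ⟩
  g (suc j) +ᵣ -ᵣ g zero ∎
  where
  open ≃-Reasoning
  tailSum : ℝ
  tailSum = sum λ r → if between zero j r then f (suc r) else fromℤ 0ℤ
  lemma : ∀ p q r → (q ℚ.+ ℚ.- p) ℚ.+ (r ℚ.+ ℚ.- q) ≡ r ℚ.+ ℚ.- p
  lemma = RingSolver.solve-∀ ℚ-ring
sum-telescope {suc n} f g f≃Δg (suc i) (suc j) (ℕ.s≤s i≤j) = begin
  fromℤ 0ℤ +ᵣ tailSum′
    ≈⟨ ℝ+.identityˡ tailSum′ ⟩
  tailSum′
    ≈⟨ sum-cong (λ r → ℝ+.reflexive (cong (λ b → if b then f (suc r) else fromℤ 0ℤ) (between-suc i j r))) ⟩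
  sum (λ r → if between i j r then f (suc r) else fromℤ 0ℤ)
    ≈⟨ sum-telescope (f ∘ suc) (g ∘ suc) (f≃Δg ∘ suc) i j i≤j ⟩
  g (suc j) +ᵣ -ᵣ g (suc i) ∎
  where
  open ≃-Reasoning
  tailSum′ : ℝ
  tailSum′ = sum λ r → if between (suc i) (suc j) (suc r) then f (suc r) else fromℤ 0ℤ

-- Orientations and the sets they cut out

-- `e` lives on all ordered pairs, not on `Coords`, so that a permutation of the indices acts on it
-- without case distinction.
Y[_] : ∀ {n} → (Fin (suc n) → Fin (suc n) → ℤ) → Pred (ℝ^Φ⁺ n) 0ℓ
Y[_] {n} e x = Σ[ t ∈ (Fin (suc n) → ℝ) ]
  (∀ i j .(i<j : i < j) → x i j i<j ≃ t j +ᵣ -ᵣ t i +ᵣ -ᵣ fromℤ (e i j))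

module _ {n} (v : Coords n ℤ) (e : Fin (suc n) → Fin (suc n) → ℤ) (h : Fin (suc n) → ℤ)
  (simple≡0 : ∀ r → simple v r ≡ 0ℤ)
  (v≡h-h-e : ∀ i j .(i<j : i < j) → v i j i<j ≡ h j ℤ.- h i ℤ.- e i j) where

  open PartialSums ℝ+.monoid

  private
    ι-v : ∀ i j .(i<j : i < j) → ι (v i j i<j) ≡ ι (h j) ℚ.- ι (h i) ℚ.- ι (e i j)
    ι-v i j i<j = trans (cong ι (v≡h-h-e i j i<j))
      (trans (ι-sub (h j ℤ.- h i) (e i j)) (cong (ℚ._- ι (e i j)) (ι-sub (h j) (h i))))

    -- As `v` vanishes at the simple roots, `e` is forced to be the increment of `h` there.
    ι-e-simple : ∀ r → ι (e (inject₁ r) (suc r)) ≡ ι (h (suc r)) ℚ.- ι (h (inject₁ r))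
    ι-e-simple r = trans
      (cong ι (sym (ℤₚ.i-j≡0⇒i≡j (h (suc r) ℤ.- h (inject₁ r)) (e (inject₁ r) (suc r))
        (trans (sym (v≡h-h-e (inject₁ r) (suc r) (≤̄⇒inject₁< ℕₚ.≤-refl))) (simple≡0 r)))))
      (ι-sub (h (suc r)) (h (inject₁ r)))

  -- With g = t - h the simple coordinates of `x` are the increments of `g`, so `simpleSum`
  -- telescopes to g j - g i; the remaining terms in `h` and `e` make up `v`.
  Y⊆X : Y[ e ] ⊆ X[ v ]
  Y⊆X {x} (t , x≃) i j i<j = begin
    x i j i<j
      ≈⟨ x≃ i j i<j ⟩
    t j +ᵣ -ᵣ t i +ᵣ -ᵣ fromℤ (e i j)
      ≈⟨ ≃-reflexive {t j +ᵣ -ᵣ t i +ᵣ -ᵣ fromℤ (e i j)} {g j +ᵣ -ᵣ g i +ᵣ fromℤ (v i j i<j)} (λ k →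
           trans (regroup (seq (t i) k) (seq (t j) k) (ι (h i)) (ι (h j)) (ι (e i j)))
                 (cong (seq (g j) k ℚ.- seq (g i) k ℚ.+_) (sym (ι-v i j i<j)))) ⟩
    g j +ᵣ -ᵣ g i +ᵣ fromℤ (v i j i<j)
      ≈⟨ +ᵣ-cong {simpleSum x i j} {g j +ᵣ -ᵣ g i} {fromℤ (v i j i<j)} {fromℤ (v i j i<j)}
           (sum-telescope (simple x) g simple≃Δg i j
             (ℕₚ.<⇒≤ (recompute (i <? j) i<j)))
           (ℝ+.refl {fromℤ (v i j i<j)}) ⟨
    simpleSum x i j +ᵣ fromℤ (v i j i<j) ∎
    where
    open ≃-Reasoning

    g : Fin (suc n) → ℝ
    g i = t i +ᵣ -ᵣ fromℤ (h i)

    regroup : ∀ a b p q r →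
      b ℚ.+ ℚ.- a ℚ.+ ℚ.- r ≡ (b ℚ.+ ℚ.- q) ℚ.- (a ℚ.+ ℚ.- p) ℚ.+ (q ℚ.- p ℚ.- r)
    regroup = RingSolver.solve-∀ ℚ-ring

    regroup′ : ∀ a b p q →
      b ℚ.+ ℚ.- a ℚ.+ ℚ.- (q ℚ.- p) ≡ (b ℚ.+ ℚ.- q) ℚ.+ ℚ.- (a ℚ.+ ℚ.- p)
    regroup′ = RingSolver.solve-∀ ℚ-ring

    simple≃Δg : ∀ r → simple x r ≃ g (suc r) +ᵣ -ᵣ g (inject₁ r)
    simple≃Δg r = ℝ+.trans {simple x r} {Δt-e} {g (suc r) +ᵣ -ᵣ g (inject₁ r)}
      (x≃ (inject₁ r) (suc r) (≤̄⇒inject₁< ℕₚ.≤-refl))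
      (≃-reflexive {Δt-e} {g (suc r) +ᵣ -ᵣ g (inject₁ r)} (λ k → trans
        (cong (λ q → seq (t (suc r)) k ℚ.+ ℚ.- seq (t (inject₁ r)) k ℚ.+ ℚ.- q) (ι-e-simple r))
        (regroup′ (seq (t (inject₁ r)) k) (seq (t (suc r)) k) (ι (h (inject₁ r))) (ι (h (suc r))))))
      where
      Δt-e : ℝ
      Δt-e = t (suc r) +ᵣ -ᵣ t (inject₁ r) +ᵣ -ᵣ fromℤ (e (inject₁ r) (suc r))

  -- The potential is rebuilt from `x` as the partial sums of its simple coordinates plus `h`.
  X⊆Y : X[ v ] ⊆ Y[ e ]
  X⊆Y {x} x∈X = t , λ i j i<j → begin
    x i j i<j
      ≈⟨ x∈X i j i<j ⟩
    simpleSum x i j +ᵣ fromℤ (v i j i<j)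
      ≈⟨ +ᵣ-cong {simpleSum x i j} {S j +ᵣ -ᵣ S i} {fromℤ (v i j i<j)} {fromℤ (v i j i<j)}
           (sum-telescope (simple x) S simple≃ΔS i j
             (ℕₚ.<⇒≤ (recompute (i <? j) i<j)))
           (ℝ+.refl {fromℤ (v i j i<j)}) ⟩
    S j +ᵣ -ᵣ S i +ᵣ fromℤ (v i j i<j)
      ≈⟨ ≃-reflexive {S j +ᵣ -ᵣ S i +ᵣ fromℤ (v i j i<j)} {t j +ᵣ -ᵣ t i +ᵣ -ᵣ fromℤ (e i j)} (λ k →
           trans (cong (seq (S j) k ℚ.- seq (S i) k ℚ.+_) (ι-v i j i<j))
                 (regroup (seq (S i) k) (seq (S j) k) (ι (h i)) (ι (h j)) (ι (e i j)))) ⟩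
    t j +ᵣ -ᵣ t i +ᵣ -ᵣ fromℤ (e i j) ∎
    where
    open ≃-Reasoning

    S t : Fin (suc n) → ℝ
    S   = partialSum (simple x)
    t i = S i +ᵣ fromℤ (h i)

    regroup : ∀ a b p q r →
      b ℚ.- a ℚ.+ (q ℚ.- p ℚ.- r) ≡ (b ℚ.+ q) ℚ.+ ℚ.- (a ℚ.+ p) ℚ.+ ℚ.- r
    regroup = RingSolver.solve-∀ ℚ-ring

    cancel : ∀ a b → a ≡ (b ℚ.+ a) ℚ.+ ℚ.- b
    cancel = RingSolver.solve-∀ ℚ-ring

    simple≃ΔS : ∀ r → simple x r ≃ S (suc r) +ᵣ -ᵣ S (inject₁ r)
    simple≃ΔS r = begin
      simple x r
        ≈⟨ ≃-reflexive {simple x r} {(S (inject₁ r) +ᵣ simple x r) +ᵣ -ᵣ S (inject₁ r)}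
             (λ k → cancel (seq (simple x r) k) (seq (S (inject₁ r)) k)) ⟩
      (S (inject₁ r) +ᵣ simple x r) +ᵣ -ᵣ S (inject₁ r)
        ≈⟨ +ᵣ-cong {S (suc r)} {S (inject₁ r) +ᵣ simple x r} { -ᵣ S (inject₁ r)} { -ᵣ S (inject₁ r)}
             (partialSum-suc (simple x) r) (ℝ+.refl { -ᵣ S (inject₁ r)}) ⟨
      S (suc r) +ᵣ -ᵣ S (inject₁ r) ∎

  Y≐X : Y[ e ] ≐ X[ v ]
  Y≐X = (λ {x} → Y⊆X {x}) , (λ {x} → X⊆Y {x})

-- The coboundary is absorbed into the potential: t′ = t + b.
Y-coboundary : ∀ {n} {e e′ : Fin (suc n) → Fin (suc n) → ℤ} (b : Fin (suc n) → ℤ) →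
  (∀ i j → e′ i j ≡ e i j ℤ.+ (b j ℤ.- b i)) → Y[ e ] ⊆ Y[ e′ ]
Y-coboundary {n} {e} {e′} b e′≡ {x} (t , x≃) = t′ , λ i j i<j →
  ℝ+.trans {x i j i<j} {t j +ᵣ -ᵣ t i +ᵣ -ᵣ fromℤ (e i j)} {t′ j +ᵣ -ᵣ t′ i +ᵣ -ᵣ fromℤ (e′ i j)}
    (x≃ i j i<j)
    (≃-reflexive {t j +ᵣ -ᵣ t i +ᵣ -ᵣ fromℤ (e i j)} {t′ j +ᵣ -ᵣ t′ i +ᵣ -ᵣ fromℤ (e′ i j)} (λ k →
      trans (regroup (seq (t i) k) (seq (t j) k) (ι (b i)) (ι (b j)) (ι (e i j)))
            (cong (λ q → seq (t′ j) k ℚ.+ ℚ.- seq (t′ i) k ℚ.+ ℚ.- q) (sym (ι-e′ i j)))))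
  where
  t′ : Fin (suc n) → ℝ
  t′ i = t i +ᵣ fromℤ (b i)

  ι-e′ : ∀ i j → ι (e′ i j) ≡ ι (e i j) ℚ.+ (ι (b j) ℚ.- ι (b i))
  ι-e′ i j = trans (cong ι (e′≡ i j))
    (trans (ι-+ (e i j) (b j ℤ.- b i)) (cong (ι (e i j) ℚ.+_) (ι-sub (b j) (b i))))

  regroup : ∀ a b p q r →
    b ℚ.+ ℚ.- a ℚ.+ ℚ.- r ≡ (b ℚ.+ q) ℚ.+ ℚ.- (a ℚ.+ p) ℚ.+ ℚ.- (r ℚ.+ (q ℚ.- p))
  regroup = RingSolver.solve-∀ ℚ-ring

-- The sum 1 in `reversal` matches the shift by -1 with which `F` turns a pair around.
record IsOrientation {n} (e : Fin n → Fin n → ℤ) : Set where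
  field
    diagonal : ∀ i → e i i ≡ 0ℤ
    reversal : ∀ {i j} → i ≢ j → e i j ℤ.+ e j i ≡ 1ℤ

module _ {n} {e e′ : Fin (suc n) → Fin (suc n) → ℤ} (o : IsOrientation e) (o′ : IsOrientation e′)
  (t : Fin (suc n) → ℝ)
  (-e≃ : ∀ i j .(i<j : i < j) → -ᵣ fromℤ (e i j) ≃ t j +ᵣ -ᵣ t i +ᵣ -ᵣ fromℤ (e′ i j)) where

  open ≃-Reasoning

  private
    Δ : Fin (suc n) → Fin (suc n) → ℤ
    Δ i j = e′ i j ℤ.- e i j

    Δ-< : ∀ i j → i < j → fromℤ (Δ i j) ≃ t j +ᵣ -ᵣ t i
    -- The trivial equality 0 ≃ 0 fills the second slot.
    Δ-< i j i<j = ≃-from-sum {fromℤ (Δ i j)} {t j +ᵣ -ᵣ t i} { -ᵣ fromℤ (e i j)}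
        {t j +ᵣ -ᵣ t i +ᵣ -ᵣ fromℤ (e′ i j)} {fromℤ 0ℤ} {fromℤ 0ℤ}
        (-e≃ i j i<j) (ℝ+.refl {fromℤ 0ℤ})
        (λ k → trans (cong (ℚ._- (seq (t j) k ℚ.+ ℚ.- seq (t i) k)) (ι-sub (e′ i j) (e i j)))
                     (lemma (seq (t i) k) (seq (t j) k) (ι (e i j)) (ι (e′ i j))))
      where
      lemma : ∀ a b p q → (q ℚ.- p) ℚ.- (b ℚ.+ ℚ.- a)
                          ≡ (ℚ.- p ℚ.- (b ℚ.+ ℚ.- a ℚ.+ ℚ.- q)) ℚ.+ (ℚ.0ℚ ℚ.- ℚ.0ℚ)
      lemma = RingSolver.solve-∀ ℚ-ring

    -- Both reversal sums are 1 and cancel in the difference. This extends the equation known for i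
    -- < j to all pairs.
    Δ-reversal : ∀ {i j} → i ≢ j → Δ i j ≡ ℤ.- Δ j i
    Δ-reversal {i} {j} i≢j = ℤₚ.i-j≡0⇒i≡j (Δ i j) (ℤ.- Δ j i) (trans
      (lemma (e i j) (e j i) (e′ i j) (e′ j i))
      (cong₂ ℤ._-_ (IsOrientation.reversal o′ i≢j) (IsOrientation.reversal o i≢j)))
      where
      lemma : ∀ a b c d → (c ℤ.- a) ℤ.- (ℤ.- (d ℤ.- b)) ≡ (c ℤ.+ d) ℤ.- (a ℤ.+ b)
      lemma = solve-∀

    Δ≃ : ∀ i j → fromℤ (Δ i j) ≃ t j +ᵣ -ᵣ t i
    Δ≃ i j with <-cmp i j
    ... | tri< i<j _ _ = Δ-< i j i<j
    ... | tri≈ _ refl _ = begin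
      fromℤ (Δ i i)
        ≈⟨ ℝ+.reflexive (cong fromℤ (cong₂ ℤ._-_ (IsOrientation.diagonal o′ i) (IsOrientation.diagonal o i))) ⟩
      fromℤ 0ℤ
        ≈⟨ ℝ+.inverseʳ (t i) ⟨
      t i +ᵣ -ᵣ t i ∎
    ... | tri> _ i≢j j<i = begin
      fromℤ (Δ i j)
        ≈⟨ ℝ+.reflexive (cong fromℤ (Δ-reversal i≢j)) ⟩
      fromℤ (ℤ.- Δ j i)
        ≈⟨ ≃-reflexive {fromℤ (ℤ.- Δ j i)} { -ᵣ fromℤ (Δ j i)} (λ _ → ι-neg (Δ j i)) ⟩
      -ᵣ fromℤ (Δ j i)
        ≈⟨ -ᵣ-cong {fromℤ (Δ j i)} {t i +ᵣ -ᵣ t j} (Δ-< j i j<i) ⟩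
      -ᵣ (t i +ᵣ -ᵣ t j)
        ≈⟨ ≃-reflexive { -ᵣ (t i +ᵣ -ᵣ t j)} {t j +ᵣ -ᵣ t i} (λ k → lemma (seq (t i) k) (seq (t j) k)) ⟩
      t j +ᵣ -ᵣ t i ∎
      where
      lemma : ∀ a b → ℚ.- (a ℚ.+ ℚ.- b) ≡ b ℚ.+ ℚ.- a
      lemma = RingSolver.solve-∀ ℚ-ring

  -- The potential differences telescope, and the equality of constants in ℝ descends to ℤ by
  -- `fromℤ-injective`.
  potential⇒cocycle : ∀ i j k → Δ i j ℤ.+ Δ j k ≡ Δ i k
  potential⇒cocycle i j k = fromℤ-injective (begin
    fromℤ (Δ i j ℤ.+ Δ j k)
      ≈⟨ ≃-reflexive {fromℤ (Δ i j ℤ.+ Δ j k)} {fromℤ (Δ i j) +ᵣ fromℤ (Δ j k)} (λ _ → ι-+ (Δ i j) (Δ j k)) ⟩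
    fromℤ (Δ i j) +ᵣ fromℤ (Δ j k)
      ≈⟨ +ᵣ-cong {fromℤ (Δ i j)} {t j +ᵣ -ᵣ t i} {fromℤ (Δ j k)} {t k +ᵣ -ᵣ t j} (Δ≃ i j) (Δ≃ j k) ⟩
    (t j +ᵣ -ᵣ t i) +ᵣ (t k +ᵣ -ᵣ t j)
      ≈⟨ ≃-reflexive {(t j +ᵣ -ᵣ t i) +ᵣ (t k +ᵣ -ᵣ t j)} {t k +ᵣ -ᵣ t i}
           (λ l → lemma (seq (t i) l) (seq (t j) l) (seq (t k) l)) ⟩
    t k +ᵣ -ᵣ t i
      ≈⟨ Δ≃ i k ⟨
    fromℤ (Δ i k) ∎)
    where
    lemma : ∀ p q r → (q ℚ.+ ℚ.- p) ℚ.+ (r ℚ.+ ℚ.- q) ≡ r ℚ.+ ℚ.- p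
    lemma = RingSolver.solve-∀ ℚ-ring

-- Evaluating the inclusion at the point with potential t = 0 exhibits e′ − e as a coboundary over ℝ.
Y⊆Y⇒cocycle : ∀ {n} {e e′ : Fin (suc n) → Fin (suc n) → ℤ} →
  IsOrientation e → IsOrientation e′ → Y[ e ] ⊆ Y[ e′ ] → ∀ i j k →
  (e′ i j ℤ.- e i j) ℤ.+ (e′ j k ℤ.- e j k) ≡ e′ i k ℤ.- e i k
Y⊆Y⇒cocycle {n} {e} {e′} o o′ Y⊆Y = potential⇒cocycle o o′ (proj₁ origin∈Y′) (proj₂ origin∈Y′)
  where
  origin : ℝ^Φ⁺ n
  origin i j _ = -ᵣ fromℤ (e i j)

  origin∈Y : Y[ e ] origin
  origin∈Y = (λ _ → fromℤ 0ℤ) , λ i j _ →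
    ≃-reflexive { -ᵣ fromℤ (e i j)} {fromℤ 0ℤ +ᵣ -ᵣ fromℤ 0ℤ +ᵣ -ᵣ fromℤ (e i j)}
      (λ k → lemma (ι (e i j)))
    where
    lemma : ∀ p → ℚ.- p ≡ ℚ.0ℚ ℚ.+ ℚ.- ℚ.0ℚ ℚ.+ ℚ.- p
    lemma = RingSolver.solve-∀ ℚ-ring

  origin∈Y′ : Y[ e′ ] origin
  origin∈Y′ = Y⊆Y {origin} origin∈Y

module _ {n} (w : W n) {e : Fin (suc n) → Fin (suc n) → ℤ} (o : IsOrientation e) where

  -- If w⁻¹ reverses the pair, the -1 in `F` splits as -e(i′,j′) - e(j′,i′): the second term cancels
  -- the one coming from -x, and the first is the one wanted.
  F-potential : ∀ {x} ((t , _) : Y[ e ] x) i j .(i<j : i < j) →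
    F w x i j i<j ≃
      t (w ⟨$⟩ˡ j) +ᵣ -ᵣ t (w ⟨$⟩ˡ i) +ᵣ -ᵣ fromℤ (e (w ⟨$⟩ˡ i) (w ⟨$⟩ˡ j))
  F-potential {x} (t , x≃) i j i<j with <-cmp (w ⟨$⟩ˡ i) (w ⟨$⟩ˡ j)
  ... | tri< i′<j′ _ _ = x≃ (w ⟨$⟩ˡ i) (w ⟨$⟩ˡ j) i′<j′
  ... | tri≈ _ i′≡j′ _ = ⊥-elim-irr (<-irrefl
    (trans (sym (inverseʳ w)) (trans (cong (w ⟨$⟩ʳ_) i′≡j′) (inverseʳ w))) i<j)
  ... | tri> _ i′≢j′ j′<i′ = begin
    -ᵣ x j′ i′ j′<i′ +ᵣ -ᵣ fromℤ 1ℤ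
      ≈⟨ +ᵣ-cong { -ᵣ x j′ i′ j′<i′} { -ᵣ y} { -ᵣ fromℤ 1ℤ} { -ᵣ fromℤ 1ℤ}
           (-ᵣ-cong {x j′ i′ j′<i′} {y} (x≃ j′ i′ j′<i′)) (ℝ+.refl { -ᵣ fromℤ 1ℤ}) ⟩
    -ᵣ y +ᵣ -ᵣ fromℤ 1ℤ
      ≈⟨ ≃-reflexive { -ᵣ y +ᵣ -ᵣ fromℤ 1ℤ} {t j′ +ᵣ -ᵣ t i′ +ᵣ -ᵣ fromℤ (e i′ j′)} (λ k →
           trans (cong (λ q → ℚ.- (seq (t i′) k ℚ.+ ℚ.- seq (t j′) k ℚ.+ ℚ.- ι (e j′ i′)) ℚ.+ ℚ.- q) ι-1)
                 (lemma (seq (t i′) k) (seq (t j′) k) (ι (e i′ j′)) (ι (e j′ i′)))) ⟩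
    t j′ +ᵣ -ᵣ t i′ +ᵣ -ᵣ fromℤ (e i′ j′) ∎
    where
    open ≃-Reasoning

    i′ j′ : Fin (suc n)
    i′ = w ⟨$⟩ˡ i
    j′ = w ⟨$⟩ˡ j

    y : ℝ
    y = t i′ +ᵣ -ᵣ t j′ +ᵣ -ᵣ fromℤ (e j′ i′)

    ι-1 : ι 1ℤ ≡ ι (e i′ j′) ℚ.+ ι (e j′ i′)
    ι-1 = trans (cong ι (sym (IsOrientation.reversal o i′≢j′))) (ι-+ (e i′ j′) (e j′ i′))

    lemma : ∀ a b p q → ℚ.- (a ℚ.+ ℚ.- b ℚ.+ ℚ.- q) ℚ.+ ℚ.- (p ℚ.+ q) ≡ b ℚ.+ ℚ.- a ℚ.+ ℚ.- p
    lemma = RingSolver.solve-∀ ℚ-ring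

  -- Potentials are carried along: t ∘ w for a preimage, t ∘ w⁻¹ for an image.
  Y-◇ : Y[ (λ i j → e (w ⟨$⟩ˡ i) (w ⟨$⟩ˡ j)) ] ≐ w ◇ Y[ e ]
  Y-◇ = (λ {y} → to {y}) , (λ {y} → from {y})
    where
    to : Y[ (λ i j → e (w ⟨$⟩ˡ i) (w ⟨$⟩ˡ j)) ] ⊆ w ◇ Y[ e ]
    to {y} (t , y≃) = x , x∈Y , λ i j i<j → begin
      y i j i<j
        ≈⟨ y≃ i j i<j ⟩
      t j +ᵣ -ᵣ t i +ᵣ -ᵣ fromℤ (e (w ⟨$⟩ˡ i) (w ⟨$⟩ˡ j))
        ≈⟨ ℝ+.reflexive (cong₂ (λ p q → t p +ᵣ -ᵣ t q +ᵣ -ᵣ fromℤ (e (w ⟨$⟩ˡ i) (w ⟨$⟩ˡ j)))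
             (inverseʳ w) (inverseʳ w)) ⟨
      t (w ⟨$⟩ʳ (w ⟨$⟩ˡ j)) +ᵣ -ᵣ t (w ⟨$⟩ʳ (w ⟨$⟩ˡ i)) +ᵣ -ᵣ fromℤ (e (w ⟨$⟩ˡ i) (w ⟨$⟩ˡ j))
        ≈⟨ F-potential {x} x∈Y i j i<j ⟨
      F w x i j i<j ∎
      where
      open ≃-Reasoning

      x : ℝ^Φ⁺ n
      x i j _ = t (w ⟨$⟩ʳ j) +ᵣ -ᵣ t (w ⟨$⟩ʳ i) +ᵣ -ᵣ fromℤ (e i j)

      x∈Y : Y[ e ] x
      x∈Y = t ∘ (w ⟨$⟩ʳ_) , λ i j i<j → ℝ+.refl {x i j i<j}

    from : w ◇ Y[ e ] ⊆ Y[ (λ i j → e (w ⟨$⟩ˡ i) (w ⟨$⟩ˡ j)) ]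
    from {y} (x , x∈Y@(t , _) , y≋Fx) = t ∘ (w ⟨$⟩ˡ_) , λ i j i<j →
      ℝ+.trans {y i j i<j} {F w x i j i<j}
        {t (w ⟨$⟩ˡ j) +ᵣ -ᵣ t (w ⟨$⟩ˡ i) +ᵣ -ᵣ fromℤ (e (w ⟨$⟩ˡ i) (w ⟨$⟩ˡ j))}
        (y≋Fx i j i<j) (F-potential {x} x∈Y i j i<j)

-- Descents

indicator : ∀ {A : Set} → Dec A → ℤ
indicator (yes _) = 1ℤ
indicator (no  _) = 0ℤ

-- This is -⌊(q - p)/n⌋, the number of times n is added to q - p to reach its residue.
descent : ∀ {n} → Fin n → Fin n → ℤ
descent p q = indicator (q <? p)

descent-≡1 : ∀ {n} {p q : Fin n} → q < p → descent p q ≡ 1ℤ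
descent-≡1 {p = p} {q} q<p with q <? p
... | yes _   = refl
... | no  q≮p = contradiction q<p q≮p

descent-≡0 : ∀ {n} {p q : Fin n} → p Fin.≤ q → descent p q ≡ 0ℤ
descent-≡0 {p = p} {q} p≤q with q <? p
... | yes q<p = contradiction q<p (ℕₚ.≤⇒≯ p≤q)
... | no  _   = refl

descent-cases : ∀ {n} (p q : Fin n) → (q < p × descent p q ≡ 1ℤ) ⊎ (p Fin.≤ q × descent p q ≡ 0ℤ)
descent-cases p q with ℕₚ.≤-<-connex (toℕ p) (toℕ q)
... | inj₁ p≤q = inj₂ (p≤q , descent-≡0 p≤q)
... | inj₂ q<p = inj₁ (q<p , descent-≡1 q<p)

-- Injectivity excludes ties, so of the two orders of a pair of distinct points exactly one is a
-- descent.
descent-isOrientation : ∀ {m n} (f : Fin m → Fin n) → (∀ {i j} → f i ≡ f j → i ≡ j) →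
  IsOrientation (λ i j → descent (f i) (f j))
descent-isOrientation f f-injective = record
  { diagonal = λ i → descent-≡0 {p = f i} ℕₚ.≤-refl
  ; reversal = λ {i} {j} → reversal i j
  }
  where
  reversal : ∀ i j → i ≢ j → descent (f i) (f j) ℤ.+ descent (f j) (f i) ≡ 1ℤ
  reversal i j i≢j with <-cmp (f i) (f j)
  ... | tri< p<q _ _ = cong₂ ℤ._+_ (descent-≡0 {p = f i} (ℕₚ.<⇒≤ p<q)) (descent-≡1 {q = f i} p<q)
  ... | tri≈ _ p≡q _ = contradiction (f-injective p≡q) i≢j
  ... | tri> _ _ q<p = cong₂ ℤ._+_ (descent-≡1 {q = f j} q<p) (descent-≡0 {p = f j} (ℕₚ.<⇒≤ q<p))

-- Up to sign these are the two admissibility inequalities for `admittedVector`. Two of the eight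
-- cases contradict transitivity of the order on positions.
descent-triangle : ∀ {n} (p q r : Fin n) →
  descent p r ℤ.≤ descent p q ℤ.+ descent q r × descent p q ℤ.+ descent q r ℤ.≤ descent p r ℤ.+ 1ℤ
descent-triangle p q r with descent-cases p q | descent-cases q r | descent-cases p r
... | inj₁ (q<p , d) | inj₁ (r<q , e) | inj₁ (r<p , f) rewrite d | e | f = ℤ.+≤+ (ℕ.s≤s ℕ.z≤n) , ℤₚ.≤-refl
... | inj₁ (q<p , d) | inj₁ (r<q , e) | inj₂ (p≤r , f) = contradiction (ℕₚ.<-trans r<q q<p) (ℕₚ.≤⇒≯ p≤r)
... | inj₁ (q<p , d) | inj₂ (q≤r , e) | inj₁ (r<p , f) rewrite d | e | f = ℤₚ.≤-refl , ℤ.+≤+ (ℕ.s≤s ℕ.z≤n)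
... | inj₁ (q<p , d) | inj₂ (q≤r , e) | inj₂ (p≤r , f) rewrite d | e | f = ℤ.+≤+ ℕ.z≤n , ℤₚ.≤-refl
... | inj₂ (p≤q , d) | inj₁ (r<q , e) | inj₁ (r<p , f) rewrite d | e | f = ℤₚ.≤-refl , ℤ.+≤+ (ℕ.s≤s ℕ.z≤n)
... | inj₂ (p≤q , d) | inj₁ (r<q , e) | inj₂ (p≤r , f) rewrite d | e | f = ℤ.+≤+ ℕ.z≤n , ℤₚ.≤-refl
... | inj₂ (p≤q , d) | inj₂ (q≤r , e) | inj₁ (r<p , f) = contradiction r<p (ℕₚ.≤⇒≯ (ℕₚ.≤-trans p≤q q≤r))
... | inj₂ (p≤q , d) | inj₂ (q≤r , e) | inj₂ (p≤r , f) rewrite d | e | f = ℤₚ.≤-refl , ℤ.+≤+ ℕ.z≤n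

-- The non-negative residue of q − p modulo n.
descent-residue : ∀ {n} (p q : Fin n) →
  ∃[ a ] a ℕ.< n × + a ≡ + toℕ q ℤ.- + toℕ p ℤ.+ + n ℤ.* descent p q
descent-residue {n} p q with descent-cases p q
... | inj₂ (p≤q , d) rewrite d = toℕ q ℕ.∸ toℕ p , ℕₚ.≤-<-trans (ℕₚ.m∸n≤m (toℕ q) (toℕ p)) (toℕ<n q) ,
  trans (sym (trans (ℤₚ.m-n≡m⊖n (toℕ q) (toℕ p)) (ℤₚ.⊖-≥ p≤q)))
        (lemma (+ toℕ q ℤ.- + toℕ p) (+ n))
  where
  lemma : ∀ u v → u ≡ u ℤ.+ v ℤ.* 0ℤ
  lemma = solve-∀
-- The truncated subtractions are exact because q < p < n, and n - (p - q) is below n because p - q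
-- is positive.
... | inj₁ (q<p , d) rewrite d = n ℕ.∸ (toℕ p ℕ.∸ toℕ q) ,
  ℕₚ.∸-monoʳ-< (ℕₚ.m<n⇒0<n∸m q<p) (ℕₚ.≤-trans (ℕₚ.m∸n≤m (toℕ p) (toℕ q)) (ℕₚ.<⇒≤ (toℕ<n p))) ,
  (begin
    + (n ℕ.∸ (toℕ p ℕ.∸ toℕ q))
      ≡⟨ ℤₚ.⊖-≥ (ℕₚ.≤-trans (ℕₚ.m∸n≤m (toℕ p) (toℕ q)) (ℕₚ.<⇒≤ (toℕ<n p))) ⟨
    n ℤ.⊖ (toℕ p ℕ.∸ toℕ q)
      ≡⟨ ℤₚ.m-n≡m⊖n n (toℕ p ℕ.∸ toℕ q) ⟨
    + n ℤ.- + (toℕ p ℕ.∸ toℕ q)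
      ≡⟨ cong (ℤ._-_ (+ n)) (trans (sym (ℤₚ.⊖-≥ (ℕₚ.<⇒≤ q<p))) (sym (ℤₚ.m-n≡m⊖n (toℕ p) (toℕ q)))) ⟩
    + n ℤ.- (+ toℕ p ℤ.- + toℕ q)
      ≡⟨ lemma (+ n) (+ toℕ p) (+ toℕ q) ⟩
    + toℕ q ℤ.- + toℕ p ℤ.+ + n ℤ.* 1ℤ ∎)
  where
  open ≡-Reasoning
  lemma : ∀ u v w → u ℤ.- (v ℤ.- w) ≡ w ℤ.- v ℤ.+ u ℤ.* 1ℤ
  lemma = solve-∀

-- Two naturals below n differ by less than n, and 0 is the only multiple of n that small.
residue-unique : ∀ {n a b} k → a ℕ.< n → b ℕ.< n → + a ℤ.- + b ≡ + n ℤ.* k → k ≡ 0ℤ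
residue-unique {n} {a} {b} k a<n b<n eq = ℤₚ.∣i∣≡0⇒i≡0 (ℕₚ.n<1⇒n≡0 (ℕₚ.*-cancelˡ-< n ℤ.∣ k ∣ 1 (begin-strict
  n ℕ.* ℤ.∣ k ∣        ≡⟨ ℤₚ.abs-* (+ n) k ⟨
  ℤ.∣ + n ℤ.* k ∣      ≡⟨ cong ℤ.∣_∣ (trans (sym eq) (ℤₚ.m-n≡m⊖n a b)) ⟩
  ℤ.∣ a ℤ.⊖ b ∣        ≤⟨ ℤₚ.∣m⊝n∣≤m⊔n a b ⟩
  a ℕ.⊔ b              <⟨ ℕₚ.⊔-lub a<n b<n ⟩
  n                    ≡⟨ ℕₚ.*-identityʳ n ⟨
  n ℕ.* 1              ∎)))
  where open ℕₚ.≤-Reasoning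

-- Rotating all positions by s modulo n changes the descents by the coboundary of the wrap counts b.
descent-rotation : ∀ {m n} (f g : Fin m → Fin n) (s : ℤ) (b : Fin m → ℤ) →
  (∀ i → + toℕ (f i) ≡ + toℕ (g i) ℤ.+ s ℤ.+ + n ℤ.* b i) →
  ∀ i j → descent (g i) (g j) ≡ descent (f i) (f j) ℤ.+ (b j ℤ.- b i)
descent-rotation {n = n} f g s b shift i j
  with descent-residue (f i) (f j) | descent-residue (g i) (g j)
... | a , a<n , a≡ | a′ , a′<n , a′≡ =
  ℤₚ.i-j≡0⇒i≡j (descent (g i) (g j)) (descent (f i) (f j) ℤ.+ (b j ℤ.- b i))
    -- The shift `s` cancels in differences of positions, so the two residues agree modulo n and the
    -- factor of n between them vanishes.
    (residue-unique _ a′<n a<n (begin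
      + a′ ℤ.- + a
        ≡⟨ cong₂ ℤ._-_ a′≡ a≡ ⟩
      (+ toℕ (g j) ℤ.- + toℕ (g i) ℤ.+ + n ℤ.* descent (g i) (g j))
        ℤ.- (+ toℕ (f j) ℤ.- + toℕ (f i) ℤ.+ + n ℤ.* descent (f i) (f j))
        ≡⟨ cong₂ (λ u v → (+ toℕ (g j) ℤ.- + toℕ (g i) ℤ.+ + n ℤ.* descent (g i) (g j))
             ℤ.- (u ℤ.- v ℤ.+ + n ℤ.* descent (f i) (f j))) (shift j) (shift i) ⟩
      (+ toℕ (g j) ℤ.- + toℕ (g i) ℤ.+ + n ℤ.* descent (g i) (g j))
        ℤ.- ((+ toℕ (g j) ℤ.+ s ℤ.+ + n ℤ.* b j) ℤ.- (+ toℕ (g i) ℤ.+ s ℤ.+ + n ℤ.* b i)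
          ℤ.+ + n ℤ.* descent (f i) (f j))
        ≡⟨ lemma (+ toℕ (g i)) (+ toℕ (g j)) s (+ n) (b i) (b j) (descent (g i) (g j)) (descent (f i) (f j)) ⟩
      + n ℤ.* (descent (g i) (g j) ℤ.- (descent (f i) (f j) ℤ.+ (b j ℤ.- b i))) ∎))
  where
  open ≡-Reasoning
  lemma : ∀ p q s n b c d d′ →
    (q ℤ.- p ℤ.+ n ℤ.* d) ℤ.- ((q ℤ.+ s ℤ.+ n ℤ.* c) ℤ.- (p ℤ.+ s ℤ.+ n ℤ.* b) ℤ.+ n ℤ.* d′)
      ≡ n ℤ.* (d ℤ.- (d′ ℤ.+ (c ℤ.- b)))
  lemma = solve-∀

-- Circular permutations

position : ∀ {n} → CircularPermutation n → Fin (suc n) → Fin (suc n)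
position (_ , a , _) = a ⟨$⟩ˡ_

position-injective : ∀ {n} (c : CircularPermutation n) {i j} → position c i ≡ position c j → i ≡ j
position-injective (_ , a , _) eq = trans (sym (inverseʳ a)) (trans (cong (a ⟨$⟩ʳ_) eq) (inverseʳ a))

orientation : ∀ {n} → CircularPermutation n → Fin (suc n) → Fin (suc n) → ℤ
orientation c i j = descent (position c i) (position c j)

orientation-isOrientation : ∀ {n} (c : CircularPermutation n) → IsOrientation (orientation c)
orientation-isOrientation c = descent-isOrientation (position c) (position-injective c)

position-successor : ∀ {n} (c : CircularPermutation n) i →
  (∃[ r ] position c i ≡ inject₁ r × position c (proj₁ c ⟨$⟩ʳ i) ≡ suc r) ⊎
  (position c i ≡ fromℕ n × position c (proj₁ c ⟨$⟩ʳ i) ≡ zero)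
position-successor {n} (c , a , step , close) i = go (view (a ⟨$⟩ˡ i)) (inverseʳ a)
  where
  go : ∀ {p} → View p → a ⟨$⟩ʳ p ≡ i →
    (∃[ r ] a ⟨$⟩ˡ i ≡ inject₁ r × a ⟨$⟩ˡ (c ⟨$⟩ʳ i) ≡ suc r) ⊎
    (a ⟨$⟩ˡ i ≡ fromℕ n × a ⟨$⟩ˡ (c ⟨$⟩ʳ i) ≡ zero)
  go ‵fromℕ       refl = inj₂ (inverseˡ a , trans (cong (a ⟨$⟩ˡ_) close) (inverseˡ a))
  go (‵inject₁ r) refl = inj₁ (r , inverseˡ a , trans (cong (a ⟨$⟩ˡ_) (step r)) (inverseˡ a))

-- The wrap count `w` is -1 at the last position and 0 elsewhere, which merges both cases of
-- `position-successor` into one integer equation.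
position-increment : ∀ {n} (c : CircularPermutation n) i →
  ∃[ w ] + toℕ (position c (proj₁ c ⟨$⟩ʳ i)) ≡ + toℕ (position c i) ℤ.+ 1ℤ ℤ.+ + suc n ℤ.* w
position-increment {n} c i with position-successor c i
... | inj₁ (r , p≡r , q≡1+r) = 0ℤ , (begin
  + toℕ (position c (proj₁ c ⟨$⟩ʳ i))
    ≡⟨ cong (+_ ∘ toℕ) q≡1+r ⟩
  1ℤ ℤ.+ + toℕ r
    ≡⟨ cong (λ m → 1ℤ ℤ.+ + m) (trans (sym (toℕ-inject₁ r)) (cong toℕ (sym p≡r))) ⟩
  1ℤ ℤ.+ + toℕ (position c i)
    ≡⟨ lemma (+ toℕ (position c i)) (+ suc n) ⟩
  + toℕ (position c i) ℤ.+ 1ℤ ℤ.+ + suc n ℤ.* 0ℤ ∎)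
  where
  open ≡-Reasoning
  lemma : ∀ p m → 1ℤ ℤ.+ p ≡ p ℤ.+ 1ℤ ℤ.+ m ℤ.* 0ℤ
  lemma = solve-∀
... | inj₂ (p≡n , q≡0) = -1ℤ , (begin
  + toℕ (position c (proj₁ c ⟨$⟩ʳ i))
    ≡⟨ cong (+_ ∘ toℕ) q≡0 ⟩
  0ℤ
    ≡⟨ lemma (+ n) ⟩
  + n ℤ.+ 1ℤ ℤ.+ (1ℤ ℤ.+ + n) ℤ.* -1ℤ
    ≡⟨ cong (λ m → + m ℤ.+ 1ℤ ℤ.+ + suc n ℤ.* -1ℤ) (trans (sym (toℕ-fromℕ n)) (cong toℕ (sym p≡n))) ⟩
  + toℕ (position c i) ℤ.+ 1ℤ ℤ.+ + suc n ℤ.* -1ℤ ∎)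
  where
  open ≡-Reasoning
  lemma : ∀ m → 0ℤ ≡ m ℤ.+ 1ℤ ℤ.+ (1ℤ ℤ.+ m) ℤ.* -1ℤ
  lemma = solve-∀

module _ {n} (c c′ : CircularPermutation n) (c≗c′ : ∀ i → proj₁ c ⟨$⟩ʳ i ≡ proj₁ c′ ⟨$⟩ʳ i) where

  private
    a′ : Fin (suc n) → Fin (suc n)
    a′ r = proj₁ (proj₂ c′) ⟨$⟩ʳ r

    offset : ℤ
    offset = + toℕ (position c (a′ zero))

    Shifted : Fin (suc n) → Set
    Shifted r = ∃[ b ] + toℕ (position c (a′ r)) ≡ + toℕ r ℤ.+ offset ℤ.+ + suc n ℤ.* b

    -- Walking along the enumeration of `c′`, each step raises the position in `c` by 1 modulo n +
    -- 1, since `c` and `c′` agree as maps; the wraps accumulate in `b`.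
    shifted : ∀ r → Shifted r
    shifted = <-weakInduction Shifted (0ℤ , lemma₀ offset (+ suc n)) shifted-suc
      where
      open ≡-Reasoning
      lemma₀ : ∀ s m → s ≡ 0ℤ ℤ.+ s ℤ.+ m ℤ.* 0ℤ
      lemma₀ = solve-∀

      lemma₁ : ∀ r s m b w → (r ℤ.+ s ℤ.+ m ℤ.* b) ℤ.+ 1ℤ ℤ.+ m ℤ.* w ≡ (1ℤ ℤ.+ r) ℤ.+ s ℤ.+ m ℤ.* (b ℤ.+ w)
      lemma₁ = solve-∀

      shifted-suc : ∀ r → Shifted (inject₁ r) → Shifted (suc r)
      shifted-suc r (b , eq) with position-increment c (a′ (inject₁ r))
      ... | w , inc = b ℤ.+ w , (begin
        + toℕ (position c (a′ (suc r)))
          ≡⟨ cong (+_ ∘ toℕ ∘ position c)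
               (trans (c≗c′ (a′ (inject₁ r))) (proj₁ (proj₂ (proj₂ c′)) r)) ⟨
        + toℕ (position c (proj₁ c ⟨$⟩ʳ a′ (inject₁ r)))
          ≡⟨ inc ⟩
        + toℕ (position c (a′ (inject₁ r))) ℤ.+ 1ℤ ℤ.+ + suc n ℤ.* w
          ≡⟨ cong (λ p → p ℤ.+ 1ℤ ℤ.+ + suc n ℤ.* w) eq ⟩
        (+ toℕ (inject₁ r) ℤ.+ offset ℤ.+ + suc n ℤ.* b) ℤ.+ 1ℤ ℤ.+ + suc n ℤ.* w
          ≡⟨ lemma₁ (+ toℕ (inject₁ r)) offset (+ suc n) b w ⟩
        (1ℤ ℤ.+ + toℕ (inject₁ r)) ℤ.+ offset ℤ.+ + suc n ℤ.* (b ℤ.+ w)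
          ≡⟨ cong (λ m → (1ℤ ℤ.+ + m) ℤ.+ offset ℤ.+ + suc n ℤ.* (b ℤ.+ w)) (toℕ-inject₁ r) ⟩
        + toℕ (suc r) ℤ.+ offset ℤ.+ + suc n ℤ.* (b ℤ.+ w) ∎)

  -- The accumulated wraps, indexed by the point instead of its position in `c′`, give the
  -- coboundary.
  Y-orientation-mono : Y[ orientation c ] ⊆ Y[ orientation c′ ]
  Y-orientation-mono {x} = Y-coboundary {e = orientation c} {orientation c′} b
    (descent-rotation (position c) (position c′) offset b (λ i →
      trans (cong (+_ ∘ toℕ ∘ position c) (sym (inverseʳ (proj₁ (proj₂ c′)))))
            (proj₂ (shifted (position c′ i))))) {x}
    where
    b : Fin (suc n) → ℤ
    b i = proj₁ (shifted (position c′ i))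

Y-orientation-cong : ∀ {n} (c c′ : CircularPermutation n) →
  (∀ i → proj₁ c ⟨$⟩ʳ i ≡ proj₁ c′ ⟨$⟩ʳ i) → Y[ orientation c ] ≐ Y[ orientation c′ ]
Y-orientation-cong c c′ c≗c′ =
  (λ {x} → Y-orientation-mono c c′ c≗c′ {x}) , (λ {x} → Y-orientation-mono c′ c (sym ∘ c≗c′) {x})

-- The wrap case would identify the last position with zero, which 1 ≤ n forbids; a cycle on a
-- single point does fix it.
successor-≢ : ∀ {n} → 1 ℕ.≤ n → (c : CircularPermutation n) → ∀ i → proj₁ c ⟨$⟩ʳ i ≢ i
successor-≢ {n} 1≤n c i ci≡i with position-successor c i
... | inj₁ (r , p≡r , q≡1+r) = contradiction
  (trans (sym (toℕ-inject₁ r)) (cong toℕ (trans (sym p≡r) (trans (cong (position c) (sym ci≡i)) q≡1+r))))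
  (ℕₚ.<⇒≢ (ℕₚ.n<1+n (toℕ r)))
... | inj₂ (p≡n , q≡0) = ℕₚ.<⇒≢ 1≤n
  (trans (cong toℕ (trans (sym q≡0) (trans (cong (position c) ci≡i) p≡n))) (toℕ-fromℕ n))

-- No point lies strictly between i and c i in the cyclic order.
successor-additive : ∀ {n} (c : CircularPermutation n) i {k} → k ≢ i →
  orientation c i (proj₁ c ⟨$⟩ʳ i) ℤ.+ orientation c (proj₁ c ⟨$⟩ʳ i) k ≡ orientation c i k
successor-additive {n} c i {k} k≢i with position-successor c i
... | inj₁ (r , p≡r , q≡1+r) rewrite p≡r | q≡1+r = trans
    (cong (ℤ._+ descent (suc r) t) (descent-≡0 {p = inject₁ r} {suc r}
      (ℕₚ.≤-trans (ℕₚ.≤-reflexive (toℕ-inject₁ r)) (ℕₚ.n≤1+n (toℕ r)))))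
    (trans (ℤₚ.+-identityˡ (descent (suc r) t)) descent-suc)
  where
  t : Fin (suc n)
  t = position c k

  t≢r : toℕ t ≢ toℕ r
  t≢r eq = k≢i (position-injective c (toℕ-injective (trans eq (trans (sym (toℕ-inject₁ r)) (cong toℕ (sym p≡r))))))

  -- As t ≠ r, the conditions t < r + 1 and t < r agree.
  descent-suc : descent (suc r) t ≡ descent (inject₁ r) t
  descent-suc with descent-cases (suc r) t
  ... | inj₂ (1+r≤t , d) = trans d (sym (descent-≡0 {p = inject₁ r} {t}
    (ℕₚ.≤-trans (ℕₚ.≤-reflexive (toℕ-inject₁ r)) (ℕₚ.<⇒≤ 1+r≤t))))
  ... | inj₁ (t<1+r , d) = trans d (sym (descent-≡1 {p = inject₁ r} {t}
    (subst (toℕ t ℕ.<_) (sym (toℕ-inject₁ r)) (ℕₚ.≤∧≢⇒< (ℕₚ.m<1+n⇒m≤n t<1+r) t≢r))))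
-- At the wrap the step from i to c i is itself a descent, and nothing precedes position zero; both
-- sides equal 1.
... | inj₂ (p≡n , q≡0) rewrite p≡n | q≡0 = trans
    (cong₂ ℤ._+_ (descent-≡1 {p = fromℕ n} {zero} (ℕₚ.≤-<-trans ℕ.z≤n t<n)) (descent-≡0 {p = zero} {t} ℕ.z≤n))
    (sym (descent-≡1 t<n))
  where
  t : Fin (suc n)
  t = position c k

  t<n : t < fromℕ n
  t<n = ℕₚ.≤∧≢⇒< (subst (toℕ t ℕ.≤_) (sym (toℕ-fromℕ n)) (toℕ≤pred[n] t))
    (λ eq → k≢i (position-injective c (trans (toℕ-injective eq) (sym p≡n))))

-- If j = c i and k = c′ i differ, then e(i,j) + e(j,k) = e(i,k) and e′(i,k) + e′(k,j) = e′(i,j).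
-- The cocycle relation between `e` and `e′` then forces e′(j,k) + e′(k,j) = 0, against `reversal`.
Y-orientation-injective : ∀ {n} → 1 ℕ.≤ n → (c c′ : CircularPermutation n) →
  Y[ orientation c ] ≐ Y[ orientation c′ ] → ∀ i → proj₁ c ⟨$⟩ʳ i ≡ proj₁ c′ ⟨$⟩ʳ i
Y-orientation-injective {n} 1≤n c c′ (Y⊆Y′ , _) i with proj₁ c ⟨$⟩ʳ i ≟ proj₁ c′ ⟨$⟩ʳ i
... | yes j≡k = j≡k
... | no  j≢k = contradiction sum≡0
  (λ eq → 1≢0 (trans (sym (IsOrientation.reversal (orientation-isOrientation c′) j≢k)) eq))
  where
  1≢0 : 1ℤ ≢ 0ℤ
  1≢0 ()

  j k : Fin (suc n)
  j = proj₁ c ⟨$⟩ʳ i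
  k = proj₁ c′ ⟨$⟩ʳ i

  e e′ : Fin (suc n) → Fin (suc n) → ℤ
  e  = orientation c
  e′ = orientation c′

  open ≡-Reasoning

  lemma : ∀ eij ejk eij′ ejk′ ekj′ →
    ejk′ ℤ.+ ekj′ ≡ ((eij′ ℤ.- eij) ℤ.+ (ejk′ ℤ.- ejk)) ℤ.- ((eij′ ℤ.- ekj′) ℤ.- (eij ℤ.+ ejk))
  lemma = solve-∀

  lemma′ : ∀ u v → (u ℤ.+ v) ℤ.- v ≡ u
  lemma′ = solve-∀

  sum≡0 : e′ j k ℤ.+ e′ k j ≡ 0ℤ
  sum≡0 = begin
    e′ j k ℤ.+ e′ k j
      ≡⟨ lemma (e i j) (e j k) (e′ i j) (e′ j k) (e′ k j) ⟩
    ((e′ i j ℤ.- e i j) ℤ.+ (e′ j k ℤ.- e j k)) ℤ.- ((e′ i j ℤ.- e′ k j) ℤ.- (e i j ℤ.+ e j k))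
      ≡⟨ cong₂ ℤ._-_
           (Y⊆Y⇒cocycle (orientation-isOrientation c) (orientation-isOrientation c′) (λ {x} → Y⊆Y′ {x}) i j k)
           (cong₂ ℤ._-_
             (trans (cong (ℤ._- e′ k j) (sym (successor-additive c′ i (successor-≢ 1≤n c i))))
                    (lemma′ (e′ i k) (e′ k j)))
             (successor-additive c i (successor-≢ 1≤n c′ i))) ⟩
    (e′ i k ℤ.- e i k) ℤ.- (e′ i k ℤ.- e i k)
      ≡⟨ ℤₚ.+-inverseʳ (e′ i k ℤ.- e i k) ⟩
    0ℤ ∎

-- The component of a cycle

module _ {n} (c : CircularPermutation n) where
  open PartialSums ℤₚ.+-0-monoid

  height : Fin (suc n) → ℤ
  height = partialSum (λ r → orientation c (inject₁ r) (suc r))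

  admittedVector : Coords n ℤ
  admittedVector i j _ = height j ℤ.- height i ℤ.- orientation c i j

  admittedVector-simple : ∀ r → simple admittedVector r ≡ 0ℤ
  admittedVector-simple r = trans
    (cong (λ z → z ℤ.- height (inject₁ r) ℤ.- e) (partialSum-suc (λ r → orientation c (inject₁ r) (suc r)) r))
    (lemma (height (inject₁ r)) e)
    where
    e : ℤ
    e = orientation c (inject₁ r) (suc r)

    lemma : ∀ u v → (u ℤ.+ v) ℤ.- u ℤ.- v ≡ 0ℤ
    lemma = solve-∀

  admittedVector-admitted : Admitted admittedVector
  admittedVector-admitted = record
    { simple≡0 = admittedVector-simple
    -- The heights telescope, so each inequality is one half of `descent-triangle`, negated and
    -- translated.
    ; lower    = λ i j k _ _ _ → subst₂ ℤ._≤_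
        (lemma₁ (height i) (height j) (height k) (orientation c i j) (orientation c j k)) refl
        (ℤₚ.+-monoʳ-≤ (height k ℤ.- height i)
          (ℤₚ.neg-mono-≤ (proj₁ (descent-triangle (position c i) (position c j) (position c k)))))
    ; upper    = λ i j k _ _ _ → subst₂ ℤ._≤_
        (lemma₂ (height k ℤ.- height i) (orientation c i k))
        (lemma₃ (height i) (height j) (height k) (orientation c i j) (orientation c j k))
        (ℤₚ.+-monoʳ-≤ (height k ℤ.- height i ℤ.+ 1ℤ)
          (ℤₚ.neg-mono-≤ (proj₂ (descent-triangle (position c i) (position c j) (position c k)))))
    }
    where
    lemma₁ : ∀ p q r u v → (r ℤ.- p) ℤ.+ ℤ.- (u ℤ.+ v) ≡ (q ℤ.- p ℤ.- u) ℤ.+ (r ℤ.- q ℤ.- v)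
    lemma₁ = solve-∀
    lemma₂ : ∀ d u → (d ℤ.+ 1ℤ) ℤ.+ ℤ.- (u ℤ.+ 1ℤ) ≡ d ℤ.- u
    lemma₂ = solve-∀
    lemma₃ : ∀ p q r u v → (r ℤ.- p ℤ.+ 1ℤ) ℤ.+ ℤ.- (u ℤ.+ v) ≡ (q ℤ.- p ℤ.- u) ℤ.+ (r ℤ.- q ℤ.- v) ℤ.+ 1ℤ
    lemma₃ = solve-∀

  component : Setoid.Carrier (H⁰ n)
  component = Y[ orientation c ] , admittedVector , admittedVector-admitted ,
    Y≐X admittedVector (orientation c) height admittedVector-simple (λ _ _ _ → refl)

-- The (n+1)-cycle r ↦ r + 1.
rotation : ∀ n → W n
rotation n = insert (fromℕ n) zero idₚ

punchIn-fromℕ : ∀ {n} (r : Fin n) → punchIn (fromℕ n) r ≡ inject₁ r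
punchIn-fromℕ zero    = refl
punchIn-fromℕ (suc r) = cong suc (punchIn-fromℕ r)

rotation-inject₁ : ∀ {n} (r : Fin n) → rotation n ⟨$⟩ʳ inject₁ r ≡ suc r
rotation-inject₁ {n} r = trans (cong (rotation n ⟨$⟩ʳ_) (sym (punchIn-fromℕ r)))
  (insert-punchIn (fromℕ n) zero idₚ r)

rotation-fromℕ : ∀ n → rotation n ⟨$⟩ʳ fromℕ n ≡ zero
rotation-fromℕ n with fromℕ n ≟ fromℕ n
... | yes _ = refl
... | no ¬p = contradiction refl ¬p

-- The rotation conjugated by the enumeration: the cycle (a₀ a₁ ... aₙ).
circular : ∀ {n} → W n → CircularPermutation n
circular {n} a = flip a ∘ₚ rotation n ∘ₚ a , a ,
  (λ r → cong (a ⟨$⟩ʳ_) (trans (cong (rotation n ⟨$⟩ʳ_) (inverseˡ a)) (rotation-inject₁ r))) ,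
  cong (a ⟨$⟩ʳ_) (trans (cong (rotation n ⟨$⟩ʳ_) (inverseˡ a)) (rotation-fromℕ n))

-- The cycle determines each next entry, so fixing the starting point removes the ambiguity by
-- rotations.
circular-injective : ∀ {n} (a a′ : W n) → a ⟨$⟩ʳ zero ≡ a′ ⟨$⟩ʳ zero →
  (∀ i → proj₁ (circular a) ⟨$⟩ʳ i ≡ proj₁ (circular a′) ⟨$⟩ʳ i) →
  ∀ r → a ⟨$⟩ʳ r ≡ a′ ⟨$⟩ʳ r
circular-injective a a′ a0≡a′0 c≗c′ = <-weakInduction (λ r → a ⟨$⟩ʳ r ≡ a′ ⟨$⟩ʳ r) a0≡a′0 λ r eq →
  trans (sym (proj₁ (proj₂ (proj₂ (circular a))) r))
    (trans (cong (proj₁ (circular a) ⟨$⟩ʳ_) eq)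
      (trans (c≗c′ (a′ ⟨$⟩ʳ inject₁ r)) (proj₁ (proj₂ (proj₂ (circular a′))) r)))

circular-cong : ∀ {n} (a a′ : W n) → a ≈ₚ a′ →
  ∀ i → proj₁ (circular a) ⟨$⟩ʳ i ≡ proj₁ (circular a′) ⟨$⟩ʳ i
circular-cong {n} a a′ a≈a′ i = trans (a≈a′ (rotation n ⟨$⟩ʳ (a ⟨$⟩ˡ i)))
  (cong (λ r → a′ ⟨$⟩ʳ (rotation n ⟨$⟩ʳ r)) (begin
    a ⟨$⟩ˡ i                        ≡⟨ inverseˡ a′ ⟨
    a′ ⟨$⟩ˡ (a′ ⟨$⟩ʳ (a ⟨$⟩ˡ i))    ≡⟨ cong (a′ ⟨$⟩ˡ_) (a≈a′ (a ⟨$⟩ˡ i)) ⟨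
    a′ ⟨$⟩ˡ (a ⟨$⟩ʳ (a ⟨$⟩ˡ i))     ≡⟨ cong (a′ ⟨$⟩ˡ_) (inverseʳ a) ⟩
    a′ ⟨$⟩ˡ i                       ∎))
  where open ≡-Reasoning

-- Admitted vectors as cyclic orders

-- Pigeonhole: punching out a missed value would inject `Fin (suc n)` into `Fin n`.
injective⇒surjective : ∀ {n} {f : Fin n → Fin n} → Injective _≡_ _≡_ f → ∀ y → ∃[ x ] f x ≡ y
injective⇒surjective {suc n} {f} f-injective y with any? (λ x → f x ≟ y)
... | yes found = found
... | no  ∄x    = contradiction
  (injective⇒≤ {f = λ x → punchOut (avoids x)}
    (λ {x} {x′} eq → f-injective (punchOut-injective (avoids x) (avoids x′) eq)))
  (ℕₚ.<⇒≱ (ℕₚ.n<1+n n))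
  where
  avoids : ∀ x → y ≢ f x
  avoids x y≡fx = ∄x (x , sym y≡fx)

injective⇒permutation : ∀ {n} (f : Fin n → Fin n) → Injective _≡_ _≡_ f → Permutation′ n
injective⇒permutation f f-injective = permutation f
  (proj₁ ∘ injective⇒surjective f-injective)
  (proj₂ ∘ injective⇒surjective f-injective)
  (λ x → f-injective (proj₂ (injective⇒surjective f-injective (f x))))

module _ {n} {_≺_ : Rel (Fin n) 0ℓ} (≺-isStrictTotalOrder : IsStrictTotalOrder _≡_ _≺_) where
  private module ≺ = IsStrictTotalOrder ≺-isStrictTotalOrder

  below : Fin n → Subset n
  below i = tabulate (λ j → does (j ≺.<? i))

  ∈-below⁺ : ∀ {i j} → j ≺ i → j ∈ below i
  ∈-below⁺ {i} {j} j≺i = lookup⇒[]= j (below i)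
    (trans (lookup∘tabulate (λ j → does (j ≺.<? i)) j) (dec-true (j ≺.<? i) j≺i))

  ∈-below⁻ : ∀ {i j} → j ∈ below i → j ≺ i
  ∈-below⁻ {i} {j} j∈ with j ≺.<? i | trans (sym (lookup∘tabulate (λ j → does (j ≺.<? i)) j)) ([]=⇒lookup j∈)
  ... | yes j≺i | _ = j≺i

  -- The bound holds because i is not below itself, so `below i` is a proper subset.
  rank : Fin n → Fin n
  rank i = fromℕ< (subst (∣ below i ∣ ℕ.<_) (∣⊤∣≡n n)
    (p⊂q⇒∣p∣<∣q∣ {p = below i} {⊤} ((λ _ → ∈⊤) , i , ∈⊤ , ≺.irrefl refl ∘ ∈-below⁻)))

  rank-mono : ∀ {i j} → i ≺ j → rank i < rank j
  rank-mono {i} {j} i≺j = subst₂ ℕ._<_ (sym (toℕ-fromℕ< _)) (sym (toℕ-fromℕ< _))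
    (p⊂q⇒∣p∣<∣q∣ {p = below i} {below j}
      ( (λ k∈ → ∈-below⁺ (≺.trans (∈-below⁻ k∈) i≺j))
      , i , ∈-below⁺ i≺j , ≺.irrefl refl ∘ ∈-below⁻))

  rank-injective : Injective _≡_ _≡_ rank
  rank-injective {i} {j} eq with ≺.compare i j
  ... | tri< i≺j _ _ = contradiction (cong toℕ eq) (ℕₚ.<⇒≢ (rank-mono i≺j))
  ... | tri≈ _ i≡j _ = i≡j
  ... | tri> _ _ j≺i = contradiction (cong toℕ (sym eq)) (ℕₚ.<⇒≢ (rank-mono j≺i))

module _ {n} {v : Coords n ℤ} (v-admitted : Admitted v) where
  open Admitted v-admitted

  -- Since xᵢⱼ stands for the floor of a real number that is not an integer, xⱼᵢ = −1 − xᵢⱼ; the value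
  -- −1 on the diagonal makes _≺_ below irreflexive.
  V : Fin (suc n) → Fin (suc n) → ℤ
  V i j with <-cmp i j
  ... | tri< i<j _ _ = v i j i<j
  ... | tri≈ _ _ _   = -1ℤ
  ... | tri> _ _ j<i = -1ℤ ℤ.- v j i j<i

  V-< : ∀ {i j} (i<j : i < j) → V i j ≡ v i j i<j
  V-< {i} {j} i<j with <-cmp i j
  ... | tri< _ _ _   = refl
  ... | tri≈ i≮j _ _ = contradiction i<j i≮j
  ... | tri> i≮j _ _ = contradiction i<j i≮j

  V-diagonal : ∀ i → V i i ≡ -1ℤ
  V-diagonal i with <-cmp i i
  ... | tri< _ i≢i _ = contradiction refl i≢i
  ... | tri≈ _ _ _   = refl
  ... | tri> _ i≢i _ = contradiction refl i≢i

  V-reversal : ∀ {i j} → i ≢ j → V j i ≡ -1ℤ ℤ.- V i j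
  V-reversal {i} {j} i≢j with <-cmp i j | <-cmp j i
  ... | tri< i<j _ _ | tri< _ _ i≮j = contradiction i<j i≮j
  ... | tri< _ _ _   | tri> _ _ _   = refl
  ... | tri< _ _ _   | tri≈ _ j≡i _ = contradiction (sym j≡i) i≢j
  ... | tri≈ _ i≡j _ | _            = contradiction i≡j i≢j
  ... | tri> _ _ j<i | tri< _ _ _   = lemma (v j i j<i)
    where
    lemma : ∀ x → x ≡ -1ℤ ℤ.- (-1ℤ ℤ.- x)
    lemma = solve-∀
  ... | tri> _ _ _   | tri≈ _ j≡i _ = contradiction (sym j≡i) i≢j
  ... | tri> _ _ j<i | tri> j≮i _ _ = contradiction j<i j≮i

  -- Three non-integers with sum 0 have floors adding up to -1 or -2; which of the two occurs is the
  -- cyclic order of the triple.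
  Balanced : ℤ → Set
  Balanced s = s ≡ -1ℤ ⊎ s ≡ -1ℤ ℤ.- 1ℤ

  cyclicSum : (i j k : Fin (suc n)) → ℤ
  cyclicSum i j k = V i j ℤ.+ V j k ℤ.+ V k i

  -- Admissibility says that d = v(i,k) - v(i,j) - v(j,k) is 0 or 1, and the cyclic sum is -1 - d.
  balanced-ordered : ∀ {i j k} → i < j → j < k → Balanced (cyclicSum i j k)
  balanced-ordered {i} {j} {k} i<j j<k =
    go (V i j) (V j k) (V k i) (V i k) (V-reversal (ℕₚ.<⇒≢ i<k ∘ cong toℕ))
      (subst₂ ℤ._≤_ (cong₂ ℤ._+_ (sym (V-< i<j)) (sym (V-< j<k))) (sym (V-< i<k))
        (lower i j k i<j j<k i<k))
      (subst₂ ℤ._≤_ (sym (V-< i<k)) (cong (ℤ._+ 1ℤ) (cong₂ ℤ._+_ (sym (V-< i<j)) (sym (V-< j<k))))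
        (upper i j k i<j j<k i<k))
    where
    i<k : i < k
    i<k = ℕₚ.<-trans i<j j<k

    between-0-1 : ∀ d → 0ℤ ℤ.≤ d → d ℤ.≤ 1ℤ → d ≡ 0ℤ ⊎ d ≡ 1ℤ
    between-0-1 (+ 0) _ _ = inj₁ refl
    between-0-1 (+ 1) _ _ = inj₂ refl
    between-0-1 (+ suc (suc _)) _ (ℤ.+≤+ (ℕ.s≤s ()))

    lemma₁ : ∀ a b d → a ℤ.+ b ℤ.+ (-1ℤ ℤ.- d) ≡ -1ℤ ℤ.- (d ℤ.- (a ℤ.+ b))
    lemma₁ = solve-∀

    lemma₂ : ∀ s → (s ℤ.+ 1ℤ) ℤ.- s ≡ 1ℤ
    lemma₂ = solve-∀

    go : ∀ a b c d → c ≡ -1ℤ ℤ.- d → a ℤ.+ b ℤ.≤ d → d ℤ.≤ a ℤ.+ b ℤ.+ 1ℤ → Balanced (a ℤ.+ b ℤ.+ c)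
    go a b c d refl l u with between-0-1 (d ℤ.- (a ℤ.+ b)) (ℤₚ.i≤j⇒0≤j-i l)
      (subst (d ℤ.- (a ℤ.+ b) ℤ.≤_) (lemma₂ (a ℤ.+ b)) (ℤₚ.+-monoˡ-≤ (ℤ.- (a ℤ.+ b)) u))
    ... | inj₁ eq = inj₁ (trans (lemma₁ a b d) (cong (ℤ._-_ -1ℤ) eq))
    ... | inj₂ eq = inj₂ (trans (lemma₁ a b d) (cong (ℤ._-_ -1ℤ) eq))

  balanced-cycle : ∀ i j k → Balanced (cyclicSum i j k) → Balanced (cyclicSum j k i)
  balanced-cycle i j k = subst Balanced (lemma (V i j) (V j k) (V k i))
    where
    lemma : ∀ a b c → a ℤ.+ b ℤ.+ c ≡ b ℤ.+ c ℤ.+ a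
    lemma = solve-∀

  -- Reversal turns a cyclic sum s into -3 - s and so exchanges -1 and -2.
  balanced-reverse : ∀ {i j k} → i ≢ j → j ≢ k → k ≢ i →
    Balanced (cyclicSum i j k) → Balanced (cyclicSum k j i)
  balanced-reverse {i} {j} {k} i≢j j≢k k≢i b =
    subst Balanced (cong₂ ℤ._+_ (cong₂ ℤ._+_ (sym (V-reversal j≢k)) (sym (V-reversal i≢j))) (sym (V-reversal k≢i)))
      (go (V i j) (V j k) (V k i) b)
    where
    lemma : ∀ a b c → (-1ℤ ℤ.- b) ℤ.+ (-1ℤ ℤ.- a) ℤ.+ (-1ℤ ℤ.- c) ≡ (-1ℤ ℤ.- 1ℤ ℤ.- 1ℤ) ℤ.- (a ℤ.+ b ℤ.+ c)
    lemma = solve-∀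

    go : ∀ a b c → Balanced (a ℤ.+ b ℤ.+ c) → Balanced ((-1ℤ ℤ.- b) ℤ.+ (-1ℤ ℤ.- a) ℤ.+ (-1ℤ ℤ.- c))
    go a b c (inj₁ eq) = inj₂ (trans (lemma a b c) (cong (ℤ._-_ (-1ℤ ℤ.- 1ℤ ℤ.- 1ℤ)) eq))
    go a b c (inj₂ eq) = inj₁ (trans (lemma a b c) (cong (ℤ._-_ (-1ℤ ℤ.- 1ℤ ℤ.- 1ℤ)) eq))

  -- Cyclic shifts reach the even arrangements of an increasing triple, and a reversal the odd ones.
  balanced : ∀ {i j k} → i ≢ j → j ≢ k → k ≢ i → Balanced (cyclicSum i j k)
  balanced {i} {j} {k} i≢j j≢k k≢i = go (<-cmp i j) (<-cmp j k) (<-cmp k i)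
    where
    go : Tri (i < j) (i ≡ j) (j < i) → Tri (j < k) (j ≡ k) (k < j) → Tri (k < i) (k ≡ i) (i < k) →
      Balanced (cyclicSum i j k)
    go (tri≈ _ i≡j _) _ _ = contradiction i≡j i≢j
    go _ (tri≈ _ j≡k _) _ = contradiction j≡k j≢k
    go _ _ (tri≈ _ k≡i _) = contradiction k≡i k≢i
    go (tri< i<j _ _) (tri< j<k _ _) _ = balanced-ordered i<j j<k
    go (tri< i<j _ _) (tri> _ _ _) (tri< k<i _ _) =
      balanced-cycle k i j (balanced-ordered k<i i<j)
    go (tri> _ _ _) (tri< j<k _ _) (tri< k<i _ _) =
      balanced-cycle k i j (balanced-cycle j k i (balanced-ordered j<k k<i))
    go (tri> _ _ j<i) (tri> _ _ k<j) _ =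
      balanced-reverse (j≢k ∘ sym) (i≢j ∘ sym) (k≢i ∘ sym) (balanced-ordered k<j j<i)
    go (tri> _ _ j<i) (tri< _ _ _) (tri> _ _ i<k) =
      balanced-reverse (j≢k ∘ sym) (i≢j ∘ sym) (k≢i ∘ sym)
        (balanced-cycle i k j (balanced-cycle j i k (balanced-ordered j<i i<k)))
    go (tri< _ _ _) (tri> _ _ k<j) (tri> _ _ i<k) =
      balanced-reverse (j≢k ∘ sym) (i≢j ∘ sym) (k≢i ∘ sym) (balanced-cycle i k j (balanced-ordered i<k k<j))

  -- Equivalent to cyclic sum -1 for the triple `zero`, `suc i`, `suc j`: starting from the base
  -- point, the cycle meets i before j.
  _≺_ : Rel (Fin n) 0ℓ
  i ≺ j = V (suc i) (suc j) ≡ V zero (suc j) ℤ.- V zero (suc i)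

  private
    0≢1+ : ∀ {i : Fin n} → zero ≢ suc i
    0≢1+ ()

  -- The balance of the triple with base point `zero`, solved for its middle term.
  V-zero : ∀ {i j} → i ≢ j → i ≺ j ⊎ V (suc i) (suc j) ≡ V zero (suc j) ℤ.- V zero (suc i) ℤ.- 1ℤ
  V-zero {i} {j} i≢j = go (V zero (suc i)) (V zero (suc j)) (V (suc i) (suc j)) (V (suc j) zero)
    (V-reversal 0≢1+) (balanced 0≢1+ (i≢j ∘ suc-injective) (0≢1+ ∘ sym))
    where
    lemma : ∀ p q d → d ≡ (p ℤ.+ d ℤ.+ (-1ℤ ℤ.- q)) ℤ.+ (q ℤ.- p) ℤ.+ 1ℤ
    lemma = solve-∀
    lemma₁ : ∀ p q → -1ℤ ℤ.+ (q ℤ.- p) ℤ.+ 1ℤ ≡ q ℤ.- p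
    lemma₁ = solve-∀
    lemma₂ : ∀ p q → (-1ℤ ℤ.- 1ℤ) ℤ.+ (q ℤ.- p) ℤ.+ 1ℤ ≡ q ℤ.- p ℤ.- 1ℤ
    lemma₂ = solve-∀

    go : ∀ p q d q′ → q′ ≡ -1ℤ ℤ.- q → Balanced (p ℤ.+ d ℤ.+ q′) → d ≡ q ℤ.- p ⊎ d ≡ q ℤ.- p ℤ.- 1ℤ
    go p q d q′ refl (inj₁ eq) = inj₁ (trans (lemma p q d)
      (trans (cong (λ z → z ℤ.+ (q ℤ.- p) ℤ.+ 1ℤ) eq) (lemma₁ p q)))
    go p q d q′ refl (inj₂ eq) = inj₂ (trans (lemma p q d)
      (trans (cong (λ z → z ℤ.+ (q ℤ.- p) ℤ.+ 1ℤ) eq) (lemma₂ p q)))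

  ≺-irrefl : ∀ {i} → ¬ i ≺ i
  ≺-irrefl {i} i≺i with trans (sym (V-diagonal (suc i))) (trans i≺i (ℤₚ.+-inverseʳ (V zero (suc i))))
  ... | ()

  -- Both relations together would make V(i,j) + V(j,i) zero, while `V-reversal` makes it -1.
  ≺-asym : ∀ {i j} → i ≺ j → ¬ j ≺ i
  ≺-asym {i} {j} i≺j j≺i with i ≟ j
  ... | yes refl = ≺-irrefl i≺j
  ... | no  i≢j  = go (V zero (suc i)) (V zero (suc j))
    (trans (sym j≺i) (trans (V-reversal (i≢j ∘ suc-injective)) (cong (ℤ._-_ -1ℤ) i≺j)))
    where
    lemma₁ : ∀ p q → (p ℤ.- q) ℤ.+ (q ℤ.- p) ≡ 0ℤ
    lemma₁ = solve-∀
    lemma₂ : ∀ p q → (-1ℤ ℤ.- (q ℤ.- p)) ℤ.+ (q ℤ.- p) ≡ -1ℤ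
    lemma₂ = solve-∀

    go : ∀ p q → ¬ p ℤ.- q ≡ -1ℤ ℤ.- (q ℤ.- p)
    go p q eq with trans (sym (lemma₁ p q)) (trans (cong (ℤ._+ (q ℤ.- p)) eq) (lemma₂ p q))
    ... | ()

  -- For distinct points, the other value in `V-zero` for i, k would cancel all terms of the cyclic
  -- sum of i, j, k and leave 0, which is not balanced.
  ≺-trans : ∀ {i j k} → i ≺ j → j ≺ k → i ≺ k
  ≺-trans {i} {j} {k} i≺j j≺k with i ≟ j | j ≟ k | i ≟ k
  ... | yes refl | _ | _ = j≺k
  ... | no _ | yes refl | _ = i≺j
  ... | no _ | no _ | yes refl = contradiction j≺k (≺-asym i≺j)
  ... | no i≢j | no j≢k | no i≢k with V-zero i≢k
  ...   | inj₁ i≺k = i≺k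
  ...   | inj₂ eq  = contradiction
    (subst Balanced
      (trans (cong₂ ℤ._+_ (cong₂ ℤ._+_ i≺j j≺k)
               (trans (V-reversal (i≢k ∘ suc-injective)) (cong (ℤ._-_ -1ℤ) eq)))
             (lemma (V zero (suc i)) (V zero (suc j)) (V zero (suc k))))
      (balanced (i≢j ∘ suc-injective) (j≢k ∘ suc-injective) (i≢k ∘ sym ∘ suc-injective)))
    λ { (inj₁ ()) ; (inj₂ ()) }
    where
    lemma : ∀ p q r → (q ℤ.- p) ℤ.+ (r ℤ.- q) ℤ.+ (-1ℤ ℤ.- (r ℤ.- p ℤ.- 1ℤ)) ≡ 0ℤ
    lemma = solve-∀

  -- `V-reversal` turns the second value in `V-zero` into the first one with i and j exchanged.
  ≺-connex : ∀ {i j} → i ≢ j → i ≺ j ⊎ j ≺ i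
  ≺-connex {i} {j} i≢j with V-zero i≢j
  ... | inj₁ i≺j = inj₁ i≺j
  ... | inj₂ eq  = inj₂ (trans (V-reversal (i≢j ∘ suc-injective))
    (trans (cong (ℤ._-_ -1ℤ) eq) (lemma (V zero (suc i)) (V zero (suc j)))))
    where
    lemma : ∀ p q → -1ℤ ℤ.- (q ℤ.- p ℤ.- 1ℤ) ≡ p ℤ.- q
    lemma = solve-∀

  ≺-compare : Trichotomous _≡_ _≺_
  ≺-compare i j with i ≟ j
  ... | yes refl = tri≈ ≺-irrefl refl ≺-irrefl
  ... | no  i≢j with ≺-connex i≢j
  ...   | inj₁ i≺j = tri< i≺j i≢j (≺-asym i≺j)
  ...   | inj₂ j≺i = tri> (≺-asym j≺i) i≢j j≺i

  ≺-isStrictTotalOrder : IsStrictTotalOrder _≡_ _≺_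
  ≺-isStrictTotalOrder = isStrictTotalOrderᶜ record
    { isEquivalence = isEquivalence
    ; trans         = λ {i} {j} {k} → ≺-trans {i} {j} {k}
    ; compare       = ≺-compare
    }

  -- `rank` sends points to positions; an enumeration goes the other way, hence the `flip`.
  sorting : Permutation′ n
  sorting = flip (injective⇒permutation (rank ≺-isStrictTotalOrder) (rank-injective ≺-isStrictTotalOrder))

  -- Takes the role of `h` in `Y≐X`. At the base point it must be 0, not the diagonal value -1 of
  -- `V`.
  potential : Fin (suc n) → ℤ
  potential zero    = 0ℤ
  potential (suc i) = V zero (suc i)

  -- `lift₀` keeps the base point at position zero, so pairs starting there are no descents. For
  -- other pairs the two values in `V-zero` match descent 0 and 1, because `rank` is monotone.
  v≡potential-orientation : ∀ i j .(i<j : i < j) →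
    v i j i<j ≡ potential j ℤ.- potential i ℤ.- orientation (circular (lift₀ sorting)) i j
  v≡potential-orientation zero (suc j) i<j = trans (sym (V-< (ℕ.s≤s ℕ.z≤n)))
    (trans (lemma (V zero (suc j)))
      (cong (ℤ._-_ (V zero (suc j) ℤ.- 0ℤ)) (sym (descent-≡0 {p = zero} {suc (rank ≺-isStrictTotalOrder j)} ℕ.z≤n))))
    where
    lemma : ∀ p → p ≡ p ℤ.- 0ℤ ℤ.- 0ℤ
    lemma = solve-∀
  v≡potential-orientation (suc i) (suc j) i<j = trans (sym (V-< i<j′)) (go (V-zero i≢j))
    where
    i<j′ : suc i < suc j
    i<j′ = recompute (suc i <? suc j) i<j

    i≢j : i ≢ j
    i≢j i≡j = ℕₚ.<⇒≢ i<j′ (cong (toℕ ∘ suc) i≡j)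

    lemma : ∀ p → p ≡ p ℤ.- 0ℤ
    lemma = solve-∀

    r : Fin n → Fin n
    r = rank ≺-isStrictTotalOrder

    go : i ≺ j ⊎ V (suc i) (suc j) ≡ V zero (suc j) ℤ.- V zero (suc i) ℤ.- 1ℤ →
      V (suc i) (suc j) ≡ V zero (suc j) ℤ.- V zero (suc i) ℤ.- descent (suc (r i)) (suc (r j))
    go (inj₁ i≺j) = trans i≺j (trans (lemma (V zero (suc j) ℤ.- V zero (suc i)))
      (cong (ℤ._-_ (V zero (suc j) ℤ.- V zero (suc i)))
        (sym (descent-≡0 {p = suc (r i)} {suc (r j)} (ℕ.s≤s (ℕₚ.<⇒≤ (rank-mono ≺-isStrictTotalOrder i≺j)))))))
    -- The second value alone does not yet provide j ≺ i; connexity does, and its other outcome is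
    -- handled by the first clause.
    go (inj₂ eq) with ≺-connex i≢j
    ... | inj₁ i≺j = go (inj₁ i≺j)
    ... | inj₂ j≺i = trans eq (cong (ℤ._-_ (V zero (suc j) ℤ.- V zero (suc i)))
        (sym (descent-≡1 {p = suc (r i)} {suc (r j)} (ℕ.s≤s (rank-mono ≺-isStrictTotalOrder j≺i)))))

  Y-sorting : Y[ orientation (circular (lift₀ sorting)) ] ≐ X[ v ]
  Y-sorting = Y≐X v (orientation (circular (lift₀ sorting))) potential simple≡0 v≡potential-orientation

-- Counting

insert-zero-cong : ∀ {n} i {π ρ : Permutation′ n} → π ≈ₚ ρ → insert zero i π ≈ₚ insert zero i ρ
insert-zero-cong i π≈ρ zero = refl
insert-zero-cong i {π} {ρ} π≈ρ (suc k) = trans (insert-punchIn zero i π k)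
  (trans (cong (punchIn i) (π≈ρ k)) (sym (insert-punchIn zero i ρ k)))

insert-zero-injective : ∀ {n} i {π ρ : Permutation′ n} → insert zero i π ≈ₚ insert zero i ρ → π ≈ₚ ρ
insert-zero-injective i {π} {ρ} eq k = punchIn-injective i (π ⟨$⟩ʳ k) (ρ ⟨$⟩ʳ k)
  (trans (sym (insert-punchIn zero i π k)) (trans (eq (suc k)) (insert-punchIn zero i ρ k)))

-- Factorial number system: the leading digit is the image of `zero`, and the remaining digits
-- encode the permutation left after removing it.
enumerate : ∀ n → Fin (n !) → Permutation′ n
enumerate zero    _ = idₚ
enumerate (suc n) k = let i , l = remQuot (n !) k in insert zero i (enumerate n l)

-- Evaluation at `zero` recovers the leading digit, and the recursion the others.
enumerate-injective : ∀ n {k l} → enumerate n k ≈ₚ enumerate n l → k ≡ l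
enumerate-injective zero    {zero} {zero} _ = refl
enumerate-injective (suc n) {k} {l} eq = begin
  k                              ≡⟨ combine-remQuot {suc n} (n !) k ⟨
  combine (proj₁ k′) (proj₂ k′)  ≡⟨ cong₂ combine i≡j (enumerate-injective n (insert-zero-injective (proj₁ l′) eq′)) ⟩
  combine (proj₁ l′) (proj₂ l′)  ≡⟨ combine-remQuot {suc n} (n !) l ⟩
  l                              ∎
  where
  open ≡-Reasoning

  k′ l′ : Fin (suc n) × Fin (n !)
  k′ = remQuot (n !) k
  l′ = remQuot (n !) l

  i≡j : proj₁ k′ ≡ proj₁ l′
  i≡j = eq zero

  eq′ : insert zero (proj₁ l′) (enumerate n (proj₂ k′)) ≈ₚ insert zero (proj₁ l′) (enumerate n (proj₂ l′))
  eq′ m = trans (cong (λ i → insert zero i (enumerate n (proj₂ k′)) ⟨$⟩ʳ m) (sym i≡j)) (eq m)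

enumerate-surjective : ∀ n (π : Permutation′ n) → ∃[ k ] enumerate n k ≈ₚ π
enumerate-surjective zero    π = zero , λ ()
enumerate-surjective (suc n) π with enumerate-surjective n (remove zero π)
... | l , eq = combine (π ⟨$⟩ʳ zero) l , λ m → trans
  (cong (λ (i , l) → insert zero i (enumerate n l) ⟨$⟩ʳ m) (remQuot-combine (π ⟨$⟩ʳ zero) l))
  (trans (insert-zero-cong (π ⟨$⟩ʳ zero) eq m) (insert-remove zero π m))

-- The two bijections

-- The cycle is written from the base point, in the form that the count by orderings of n points
-- also uses.
component-surjective : ∀ {n} (y : Setoid.Carrier (H⁰ n)) →
  ∃[ π ] Y[ orientation (circular (lift₀ {n} π)) ] ≐ proj₁ y
component-surjective (_ , _ , v-admitted , P≐X) =
  sorting v-admitted , ≐-trans (Y-sorting v-admitted) (≐-sym P≐X)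

theorem1p3 : (n : ℕ) → 1 ≤ n →
    (Σ[ Ψ ∈ Bijection (Circular n) (H⁰ n) ]
    ((σ : W n) (c : CircularPermutation n) →
    proj₁ (Bijection.to Ψ (conj σ c)) ≐ σ ◇ proj₁ (Bijection.to Ψ c)))
    × Bijection (setoid (Fin (n !))) (H⁰ n)
-- `conj` replaces the enumeration a by σ ∘ a, so the positions for σcσ⁻¹ are by computation those
-- for c precomposed with σ⁻¹, and `Y-◇` applies as it stands.
theorem1p3 n 1≤n = (Ψ , λ σ c → Y-◇ σ (orientation-isOrientation c)) , record
  { to        = component ∘ cycle
  ; cong      = λ { refl → (λ x∈Y → x∈Y) , (λ x∈Y → x∈Y) }
  ; bijective =
      -- Both enumerations start at `zero` by `lift₀`, so equal cycles give equal enumerations.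
      (λ {k} {l} eq → enumerate-injective n (λ i → suc-injective
        (circular-injective (lift₀ (enumerate n k)) (lift₀ (enumerate n l)) refl
          (Y-orientation-injective 1≤n (cycle k) (cycle l) eq) (suc i))))
    , λ y → let π , Yπ≐y = component-surjective y
                k , eq   = enumerate-surjective n π in
        k , λ { refl → ≐-trans
          (Y-orientation-cong (cycle k) (circular (lift₀ π))
            (circular-cong (lift₀ (enumerate n k)) (lift₀ π) (lift₀-cong (enumerate n k) π eq)))
          Yπ≐y }
  }
  where
  cycle : Fin (n !) → CircularPermutation n
  cycle k = circular (lift₀ (enumerate n k))

  Ψ : Bijection (Circular n) (H⁰ n)
  Ψ = record
    { to        = component
    ; cong      = λ {c} {c′} → Y-orientation-cong c c′
    ; bijective =
        (λ {c} {c′} → Y-orientation-injective 1≤n c c′)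
      , λ y → let π , Yπ≐y = component-surjective y in
          circular (lift₀ π) , λ {c} c≗ →
            ≐-trans (Y-orientation-cong c (circular (lift₀ π)) c≗) Yπ≐y
    }
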